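{- For all contexts $\Gamma,\Delta,\Lambda$ and processes $P,Q$: if $\Gamma;\Delta\vdash P::\Lambda$ is derivable in $\pi\mathsf{ULL}$ and $P\equiv Q$, then $\Gamma;\Delta\vdash Q::\Lambda$ is derivable in $\pi\mathsf{ULL}$.
   Context: **Types.** $A,B::=\mathbf 1\mid\bot\mid A\otimes B\mid A\multimap B\mid \oplus\{i:A_i\}_{i\in I}\mid \&\{i:A_i\}_{i\in I}\mid {!}A\mid {?}A$ (labelled $n$-ary choices, $I$ a finite set of labels). **Duality** $A^\perp$ (an involution): $\mathbf 1^\perp=\bot$, $\bot^\perp=\mathbf 1$, $(A\otimes B)^\perp=A\multimap B^\perp$, $(A\multimap B)^\perp=A\otimes B^\perp$, $(\oplus\{i:A_i\}_{i\in I})^\perp=\&\{i:A_i^\perp\}_{i\in I}$, $(\&\{i:A_i\}_{i\in I})^\perp=\oplus\{i:A_i^\perp\}_{i\in I}$, $({!}A)^\perp={?}A^\perp$, $({?}A)^\perp={!}A^\perp$. Abbreviation: $A\mathbin{⅋}B:=A^\perp\multimap B$. **Processes.** $P,Q::=\mathbf 0\mid \nu x\,P\mid P\,|\,Q\mid x[y].P$ (send $y$ on $x$) $\mid x(y).P$ (receive) $\mid x\triangleleft \ell.P$ (select) $\mid x\triangleright\{i:P_i\}_{i\in I}$ (branch) $\mid {!}x(y).P$ (replicated receive) $\mid [x\leftrightarrow y]$ (forwarder) $\mid x[\,].P$ (empty send) $\mid x(\,).P$ (empty receive). The name $y$ is bound in $\nu y\,P$, $x(y).P$, ${!}x(y).P$;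 other occurrences are free ($\mathrm{fn}(P)$). Processes are identified up to $\alpha$-renaming, bound names are distinct from each other and from free names; $P\{y/x\}$ is capture-avoiding substitution. **Structural congruence** $\equiv$: the least congruence (closed under all process contexts) containing $\nu x(P|Q)\equiv\nu x(Q|P)$; $\nu x(P|\nu y(Q|R))\equiv\nu y(Q|\nu x(P|R))$ when $x\notin\mathrm{fn}(Q)$, $y\notin\mathrm{fn}(P)$; and $\nu x(P|\nu y(Q|R))\equiv\nu y(\nu x(P|Q)|R)$ when $x\notin\mathrm{fn}(R)$, $y\notin\mathrm{fn}(P)$. **Type system $\pi\mathsf{ULL}$.** Judgments $\Gamma;\Delta\vdash P::\Lambda$, where $\Gamma$ (unrestricted) and $\Delta,\Lambda$ (linear) are finite sets of assignments $x:A$ with distinct names; comma is disjoint union; $\emptyset$ is the empty context. Rules (premises $\Rightarrow$ conclusion; $\Gamma$ is shared): (idR) $\Gamma;x:A\vdash[x\leftrightarrow y]::y:A$. (idL) $\Gamma;x:A,y:A^\perp\vdash[x\leftrightarrow y]::\emptyset$. (1R) $\Gamma;\emptyset\vdash x[\,].\mathbf 0::x:\mathbf 1$. (1L) $\Gamma;\Delta\vdash P::\Lambda\Rightarrow\Gamma;\Delta,x:\mathbf 1\vdash x(\,).P::\Lambda$. (⊥R) $\Gamma;\Delta\vdash P::\Lambda\Rightarrow\Gamma;\Delta\vdash x(\,).P::\Lambda,x:\bot$. (⊥L) $\Gamma;x:\bot\vdash x[\,].\mathbf 0::\emptyset$. (⊗R) $\Gamma;\Delta\vdash P::\Lambda,y:A$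 and $\Gamma;\Delta'\vdash Q::\Lambda',x:B\Rightarrow\Gamma;\Delta,\Delta'\vdash\nu y\,x[y].(P|Q)::\Lambda,\Lambda',x:A\otimes B$. (⊗L) $\Gamma;\Delta,y:A,x:B\vdash P::\Lambda\Rightarrow\Gamma;\Delta,x:A\otimes B\vdash x(y).P::\Lambda$. (⅋R) $\Gamma;\Delta\vdash P::\Lambda,y:A,x:B\Rightarrow\Gamma;\Delta\vdash x(y).P::\Lambda,x:A⅋B$. (⅋L) $\Gamma;\Delta,y:A\vdash P::\Lambda$ and $\Gamma;\Delta',x:B\vdash Q::\Lambda'\Rightarrow\Gamma;\Delta,\Delta',x:A⅋B\vdash\nu y\,x[y].(P|Q)::\Lambda,\Lambda'$. (⊸R) $\Gamma;\Delta,y:A\vdash P::\Lambda,x:B\Rightarrow\Gamma;\Delta\vdash x(y).P::\Lambda,x:A\multimap B$. (⊸L) $\Gamma;\Delta\vdash P::\Lambda,y:A$ and $\Gamma;\Delta',x:B\vdash Q::\Lambda'\Rightarrow\Gamma;\Delta,\Delta',x:A\multimap B\vdash\nu y\,x[y].(P|Q)::\Lambda,\Lambda'$. (⊕R) $\Gamma;\Delta\vdash P::\Lambda,x:A_j$, $j\in I\Rightarrow\Gamma;\Delta\vdash x\triangleleft j.P::\Lambda,x:\oplus\{i:A_i\}_{i\in I}$. (⊕L) $\forall i\in I.\ \Gamma;\Delta,x:A_i\vdash P_i::\Lambda\Rightarrow\Gamma;\Delta,x:\oplus\{i:A_i\}_{i\in I}\vdash x\triangleright\{i:P_i\}_{i\in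 I}::\Lambda$. (&R) $\forall i\in I.\ \Gamma;\Delta\vdash P_i::\Lambda,x:A_i\Rightarrow\Gamma;\Delta\vdash x\triangleright\{i:P_i\}_{i\in I}::\Lambda,x:\&\{i:A_i\}_{i\in I}$. (&L) $\Gamma;\Delta,x:A_j\vdash P::\Lambda$, $j\in I\Rightarrow\Gamma;\Delta,x:\&\{i:A_i\}_{i\in I}\vdash x\triangleleft j.P::\Lambda$. (copyR) $\Gamma,u:A;\Delta\vdash P::\Lambda,x:A^\perp\Rightarrow\Gamma,u:A;\Delta\vdash\nu x\,u[x].P::\Lambda$. (copyL) $\Gamma,u:A;\Delta,x:A\vdash P::\Lambda\Rightarrow\Gamma,u:A;\Delta\vdash\nu x\,u[x].P::\Lambda$. (!R) $\Gamma;\emptyset\vdash P::y:A\Rightarrow\Gamma;\emptyset\vdash{!}x(y).P::x:{!}A$. (!L) $\Gamma,u:A;\Delta\vdash P::\Lambda\Rightarrow\Gamma;\Delta,x:{!}A\vdash P\{x/u\}::\Lambda$. (?R) $\Gamma,u:A;\Delta\vdash P::\Lambda\Rightarrow\Gamma;\Delta\vdash P\{x/u\}::\Lambda,x:{?}A^\perp$. (?L) $\Gamma;y:A\vdash P::\emptyset\Rightarrow\Gamma;x:{?}A\vdash{!}x(y).P::\emptyset$. (cutRL) $\Gamma;\Delta\vdash P::\Lambda,x:A$ and $\Gamma;\Delta',x:A\vdash Q::\Lambda'\Rightarrow\Gamma;\Delta,\Delta'\vdash\nu x(P|Q)::\Lambda,\Lambda'$. (cutLR) $\Gamma;\Delta,x:A\vdash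 P::\Lambda$ and $\Gamma;\Delta'\vdash Q::\Lambda',x:A\Rightarrow$ same conclusion. (cutRR) $\Gamma;\Delta\vdash P::\Lambda,x:A$ and $\Gamma;\Delta'\vdash Q::\Lambda',x:A^\perp\Rightarrow$ same. (cutLL) $\Gamma;\Delta,x:A\vdash P::\Lambda$ and $\Gamma;\Delta',x:A^\perp\vdash Q::\Lambda'\Rightarrow$ same. (cut!R) $\Gamma,u:A;\Delta\vdash P::\Lambda$ and $\Gamma;\emptyset\vdash Q::x:A\Rightarrow\Gamma;\Delta\vdash\nu u(P|{!}u(x).Q)::\Lambda$. (cut!L) $\Gamma;\emptyset\vdash P::x:A$ and $\Gamma,u:A;\Delta\vdash Q::\Lambda\Rightarrow\Gamma;\Delta\vdash\nu u({!}u(x).P|Q)::\Lambda$. (cut?R) $\Gamma,u:A;\Delta\vdash P::\Lambda$ and $\Gamma;x:A^\perp\vdash Q::\emptyset\Rightarrow\Gamma;\Delta\vdash\nu u(P|{!}u(x).Q)::\Lambda$. (cut?L) $\Gamma;x:A^\perp\vdash P::\emptyset$ and $\Gamma,u:A;\Delta\vdash Q::\Lambda\Rightarrow\Gamma;\Delta\vdash\nu u({!}u(x).P|Q)::\Lambda$.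
   Formalization: The label sets I of choices and branchings are required to be nonempty; with I empty, z▷{} is typable with any linear context without mentioning its names, and the scope laws of ≡ then fail to preserve typing. -}

module Defs where

open import Data.Fin.Base using (Fin; zero; suc; lift)
open import Data.List.Base using (List; []; _∷_)
open import Data.List.Relation.Unary.AllPairs using (AllPairs)
open import Data.Maybe using (Maybe; just; nothing; _<∣>_; Is-just)
open import Data.Nat.Base using (ℕ; zero; suc)
open import Data.Product.Base using (_×_)
open import Data.Vec.Base using (Vec; _∷_; lookup; replicate; zipWith; _[_]≔_)
open import Relation.Nullary.Negation using (¬_)

-- Labels are natural numbers.  Branches A is the type of families of
-- elements of A indexed by a finite, nonempty set I of labels:
-- constructors describe labels 0, 1, 2, … in turn, up to the largest
-- label of I.  Hence every family has exactly one representation.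
--
-- I has to be nonempty: x ▷ {} would be typable against every linear
-- context without mentioning the names in it, and typing would then not
-- be preserved by the scope laws of structural congruence.

Label : Set
Label = ℕ

data Branches (A : Set) : Set where
  last : A → Branches A               -- I = {0}
  cons : A → Branches A → Branches A  -- 0 ∈ I; the rest is shifted by 1
  skip : Branches A → Branches A      -- 0 ∉ I; the rest is shifted by 1

-- as [ j ]= a means that j ∈ I and a is the entry at j.

data _[_]=_ {A : Set} : Branches A → Label → A → Set where
  last  : ∀ {a} → last a [ zero ]= a
  here  : ∀ {a as} → cons a as [ zero ]= a
  there : ∀ {a b as j} → as [ j ]= a → cons b as [ suc j ]= a
  skip  : ∀ {a as j} → as [ j ]= a → skip as [ suc j ]= a

-- Both families have the same label set I, and R aᵢ bᵢ for all i ∈ I.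

data Pointwise {A B : Set} (R : A → B → Set) :
               Branches A → Branches B → Set where
  last : ∀ {a b} → R a b → Pointwise R (last a) (last b)
  cons : ∀ {a b as bs} → R a b → Pointwise R as bs →
         Pointwise R (cons a as) (cons b bs)
  skip : ∀ {as bs} → Pointwise R as bs → Pointwise R (skip as) (skip bs)

infixr 7 _⊗_ _⊸_ _⅋_
infix  8 !_ ⁇_
infix  9 _^⊥

data Type : Set where
  𝟏 ⊥     : Type
  _⊗_ _⊸_ : Type → Type → Type
  ⊕_ &_   : Branches Type → Type
  !_ ⁇_   : Type → Type

mutual
  _^⊥ : Type → Type
  𝟏 ^⊥       = ⊥
  ⊥ ^⊥       = 𝟏
  (A ⊗ B) ^⊥ = A ⊸ B ^⊥
  (A ⊸ B) ^⊥ = A ⊗ B ^⊥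
  (⊕ As) ^⊥  = & dualAll As
  (& As) ^⊥  = ⊕ dualAll As
  (! A) ^⊥   = ⁇ (A ^⊥)
  (⁇ A) ^⊥   = ! (A ^⊥)

  dualAll : Branches Type → Branches Type
  dualAll (last A)    = last (A ^⊥)
  dualAll (cons A As) = cons (A ^⊥) (dualAll As)
  dualAll (skip As)   = skip (dualAll As)

_⅋_ : Type → Type → Type
A ⅋ B = A ^⊥ ⊸ B

-- Processes up to α-renaming, in well-scoped de Bruijn form: Proc n has
-- its free names among n names, and a binder adds the name zero to the
-- scope of its body.

infixr 6 _∣_

data Proc (n : ℕ) : Set where
  𝟎      : Proc n
  ν      : Proc (suc n) → Proc n                     -- νx P
  _∣_    : Proc n → Proc n → Proc n                  -- P | Q
  send   : Fin n → Fin n → Proc n → Proc n           -- x[y].P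
  recv   : Fin n → Proc (suc n) → Proc n             -- x(y).P
  select : Fin n → Label → Proc n → Proc n           -- x ◁ ℓ.P
  branch : Fin n → Branches (Proc n) → Proc n        -- x ▷ {i : Pᵢ}
  serve  : Fin n → Proc (suc n) → Proc n             -- !x(y).P
  fwd    : Fin n → Fin n → Proc n                    -- [x ↔ y]
  close  : Fin n → Proc n → Proc n                   -- x[].P
  wait   : Fin n → Proc n → Proc n                   -- x().P

mutual
  rename : ∀ {m n} → (Fin m → Fin n) → Proc m → Proc n
  rename ρ 𝟎              = 𝟎
  rename ρ (ν P)          = ν (rename (lift 1 ρ) P)
  rename ρ (P ∣ Q)        = rename ρ P ∣ rename ρ Q
  rename ρ (send x y P)   = send (ρ x) (ρ y) (rename ρ P)
  rename ρ (recv x P)     = recv (ρ x) (rename (lift 1 ρ) P)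
  rename ρ (select x ℓ P) = select (ρ x) ℓ (rename ρ P)
  rename ρ (branch x Ps)  = branch (ρ x) (renameAll ρ Ps)
  rename ρ (serve x P)    = serve (ρ x) (rename (lift 1 ρ) P)
  rename ρ (fwd x y)      = fwd (ρ x) (ρ y)
  rename ρ (close x P)    = close (ρ x) (rename ρ P)
  rename ρ (wait x P)     = wait (ρ x) (rename ρ P)

  renameAll : ∀ {m n} → (Fin m → Fin n) → Branches (Proc m) → Branches (Proc n)
  renameAll ρ (last P)    = last (rename ρ P)
  renameAll ρ (cons P Ps) = cons (rename ρ P) (renameAll ρ Ps)
  renameAll ρ (skip Ps)   = skip (renameAll ρ Ps)

-- P ⟨ x ⟩ is P{x/u}, where u is the name zero of P.

_/zero : ∀ {n} → Fin n → Fin (suc n) → Fin n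
(x /zero) zero    = x
(x /zero) (suc i) = i

_⟨_⟩ : ∀ {n} → Proc (suc n) → Fin n → Proc n
P ⟨ x ⟩ = rename (x /zero) P

swap : ∀ {n} → Fin (suc (suc n)) → Fin (suc (suc n))
swap zero          = suc zero
swap (suc zero)    = zero
swap (suc (suc i)) = suc (suc i)

-- Adds a fresh name as the second innermost one.  In the scope of two
-- nested restrictions, the processes in which the outer name is not free
-- are exactly those of the form wk P.

wk : ∀ {n} → Proc (suc n) → Proc (suc (suc n))
wk = rename (lift 1 suc)

-- In the laws assoc-comm and assoc, let x be the outer and y the inner
-- restricted name of the left-hand side; on the right-hand side y is the
-- outer one.  P, outside the scope of y on the left, has y ∉ fn(P), and
-- wk expresses x ∉ fn(Q), respectively x ∉ fn(R).

infix 4 _≅_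

data _≅_ {n : ℕ} : Proc n → Proc n → Set where

  comm : ∀ {P Q} → ν (P ∣ Q) ≅ ν (Q ∣ P)

  -- νx(P|νy(Q|R)) ≡ νy(Q|νx(P|R))
  assoc-comm : ∀ {P Q R} →
    ν (P ∣ ν (wk Q ∣ R)) ≅ ν (Q ∣ ν (wk P ∣ rename swap R))

  -- νx(P|νy(Q|R)) ≡ νy(νx(P|Q)|R)
  assoc : ∀ {P Q R} →
    ν (P ∣ ν (Q ∣ wk R)) ≅ ν (ν (wk P ∣ rename swap Q) ∣ R)

  ≅-refl  : ∀ {P} → P ≅ P
  ≅-sym   : ∀ {P Q} → P ≅ Q → Q ≅ P
  ≅-trans : ∀ {P Q R} → P ≅ Q → Q ≅ R → P ≅ R

  ν      : ∀ {P Q} → P ≅ Q → ν P ≅ ν Q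
  _∣_    : ∀ {P P′ Q Q′} → P ≅ P′ → Q ≅ Q′ → P ∣ Q ≅ P′ ∣ Q′
  send   : ∀ {x y P Q} → P ≅ Q → send x y P ≅ send x y Q
  recv   : ∀ {x P Q} → P ≅ Q → recv x P ≅ recv x Q
  select : ∀ {x ℓ P Q} → P ≅ Q → select x ℓ P ≅ select x ℓ Q
  branch : ∀ {x Ps Qs} → Pointwise _≅_ Ps Qs → branch x Ps ≅ branch x Qs
  serve  : ∀ {x P Q} → P ≅ Q → serve x P ≅ serve x Q
  close  : ∀ {x P Q} → P ≅ Q → close x P ≅ close x Q
  wait   : ∀ {x P Q} → P ≅ Q → wait x P ≅ wait x Q

-- Finite sets of assignments with distinct names, i.e. finite partial
-- maps from names to types.

Ctx : ℕ → Set
Ctx n = Vec (Maybe Type) n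

∅ : ∀ {n} → Ctx n
∅ = replicate _ nothing

infixl 5 _⸴_ _▸_ _↑
infix  6 _∶_

_∶_ : ∀ {n} → Fin n → Type → Ctx n
x ∶ A = ∅ [ x ]≔ just A

-- Only meaningful as the union of contexts without common names, which
-- the typing rules ensure through Distinct.

_⸴_ : ∀ {n} → Ctx n → Ctx n → Ctx n
_⸴_ = zipWith _<∣>_

-- Contexts in the scope of an additional binder, whose name is assigned
-- the type A (Γ ▸ A) or does not occur in the context (Γ ↑).

pattern _▸_ Γ A = just A ∷ Γ
pattern _↑ Γ    = nothing ∷ Γ

_∈dom_ : ∀ {n} → Fin n → Ctx n → Set
x ∈dom Γ = Is-just (lookup Γ x)

Disjoint : ∀ {n} → Ctx n → Ctx n → Set
Disjoint Γ Δ = ∀ x → ¬ (x ∈dom Γ × x ∈dom Δ)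

Distinct : ∀ {n} → List (Ctx n) → Set
Distinct = AllPairs Disjoint

-- Γ ⨾ Δ ⊢ P ⦂ Λ is the judgment Γ; Δ ⊢ P :: Λ.  The names assigned in
-- Γ, Δ and Λ are distinct: the Distinct premise of each rule says so for
-- its conclusion, including the parts joined by commas.

infix 3 _⨾_⊢_⦂_

data _⨾_⊢_⦂_ {n : ℕ} : Ctx n → Ctx n → Proc n → Ctx n → Set where

  idR : ∀ {Γ x y A} → Distinct (Γ ∷ x ∶ A ∷ y ∶ A ∷ []) →
    Γ ⨾ x ∶ A ⊢ fwd x y ⦂ y ∶ A

  idL : ∀ {Γ x y A} → Distinct (Γ ∷ x ∶ A ∷ y ∶ A ^⊥ ∷ []) →
    Γ ⨾ x ∶ A ⸴ y ∶ A ^⊥ ⊢ fwd x y ⦂ ∅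

  𝟏R : ∀ {Γ x} → Distinct (Γ ∷ x ∶ 𝟏 ∷ []) →
    Γ ⨾ ∅ ⊢ close x 𝟎 ⦂ x ∶ 𝟏

  𝟏L : ∀ {Γ Δ Λ P x} → Distinct (Γ ∷ Δ ∷ x ∶ 𝟏 ∷ Λ ∷ []) →
    Γ ⨾ Δ ⊢ P ⦂ Λ →
    Γ ⨾ Δ ⸴ x ∶ 𝟏 ⊢ wait x P ⦂ Λ

  ⊥R : ∀ {Γ Δ Λ P x} → Distinct (Γ ∷ Δ ∷ Λ ∷ x ∶ ⊥ ∷ []) →
    Γ ⨾ Δ ⊢ P ⦂ Λ →
    Γ ⨾ Δ ⊢ wait x P ⦂ Λ ⸴ x ∶ ⊥

  ⊥L : ∀ {Γ x} → Distinct (Γ ∷ x ∶ ⊥ ∷ []) →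
    Γ ⨾ x ∶ ⊥ ⊢ close x 𝟎 ⦂ ∅

  ⊗R : ∀ {Γ Δ Δ′ Λ Λ′ P Q x A B} →
    Distinct (Γ ∷ Δ ∷ Δ′ ∷ Λ ∷ Λ′ ∷ x ∶ A ⊗ B ∷ []) →
    Γ ↑ ⨾ Δ ↑ ⊢ P ⦂ Λ ▸ A →
    Γ ↑ ⨾ Δ′ ↑ ⊢ Q ⦂ (Λ′ ⸴ x ∶ B) ↑ →
    Γ ⨾ Δ ⸴ Δ′ ⊢ ν (send (suc x) zero (P ∣ Q)) ⦂ Λ ⸴ Λ′ ⸴ x ∶ A ⊗ B

  ⊗L : ∀ {Γ Δ Λ P x A B} →
    Distinct (Γ ∷ Δ ∷ x ∶ A ⊗ B ∷ Λ ∷ []) →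
    Γ ↑ ⨾ Δ ⸴ x ∶ B ▸ A ⊢ P ⦂ Λ ↑ →
    Γ ⨾ Δ ⸴ x ∶ A ⊗ B ⊢ recv x P ⦂ Λ

  ⅋R : ∀ {Γ Δ Λ P x A B} →
    Distinct (Γ ∷ Δ ∷ Λ ∷ x ∶ A ⅋ B ∷ []) →
    Γ ↑ ⨾ Δ ↑ ⊢ P ⦂ Λ ⸴ x ∶ B ▸ A →
    Γ ⨾ Δ ⊢ recv x P ⦂ Λ ⸴ x ∶ A ⅋ B

  ⅋L : ∀ {Γ Δ Δ′ Λ Λ′ P Q x A B} →
    Distinct (Γ ∷ Δ ∷ Δ′ ∷ x ∶ A ⅋ B ∷ Λ ∷ Λ′ ∷ []) →
    Γ ↑ ⨾ Δ ▸ A ⊢ P ⦂ Λ ↑ →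
    Γ ↑ ⨾ (Δ′ ⸴ x ∶ B) ↑ ⊢ Q ⦂ Λ′ ↑ →
    Γ ⨾ Δ ⸴ Δ′ ⸴ x ∶ A ⅋ B ⊢ ν (send (suc x) zero (P ∣ Q)) ⦂ Λ ⸴ Λ′

  ⊸R : ∀ {Γ Δ Λ P x A B} →
    Distinct (Γ ∷ Δ ∷ Λ ∷ x ∶ A ⊸ B ∷ []) →
    Γ ↑ ⨾ Δ ▸ A ⊢ P ⦂ (Λ ⸴ x ∶ B) ↑ →
    Γ ⨾ Δ ⊢ recv x P ⦂ Λ ⸴ x ∶ A ⊸ B

  ⊸L : ∀ {Γ Δ Δ′ Λ Λ′ P Q x A B} →
    Distinct (Γ ∷ Δ ∷ Δ′ ∷ x ∶ A ⊸ B ∷ Λ ∷ Λ′ ∷ []) →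
    Γ ↑ ⨾ Δ ↑ ⊢ P ⦂ Λ ▸ A →
    Γ ↑ ⨾ (Δ′ ⸴ x ∶ B) ↑ ⊢ Q ⦂ Λ′ ↑ →
    Γ ⨾ Δ ⸴ Δ′ ⸴ x ∶ A ⊸ B ⊢ ν (send (suc x) zero (P ∣ Q)) ⦂ Λ ⸴ Λ′

  ⊕R : ∀ {Γ Δ Λ P x As A j} →
    Distinct (Γ ∷ Δ ∷ Λ ∷ x ∶ ⊕ As ∷ []) →
    As [ j ]= A →
    Γ ⨾ Δ ⊢ P ⦂ Λ ⸴ x ∶ A →
    Γ ⨾ Δ ⊢ select x j P ⦂ Λ ⸴ x ∶ ⊕ As

  ⊕L : ∀ {Γ Δ Λ Ps x As} →
    Distinct (Γ ∷ Δ ∷ x ∶ ⊕ As ∷ Λ ∷ []) →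
    Pointwise (λ A P → Γ ⨾ Δ ⸴ x ∶ A ⊢ P ⦂ Λ) As Ps →
    Γ ⨾ Δ ⸴ x ∶ ⊕ As ⊢ branch x Ps ⦂ Λ

  &R : ∀ {Γ Δ Λ Ps x As} →
    Distinct (Γ ∷ Δ ∷ Λ ∷ x ∶ & As ∷ []) →
    Pointwise (λ A P → Γ ⨾ Δ ⊢ P ⦂ Λ ⸴ x ∶ A) As Ps →
    Γ ⨾ Δ ⊢ branch x Ps ⦂ Λ ⸴ x ∶ & As

  &L : ∀ {Γ Δ Λ P x As A j} →
    Distinct (Γ ∷ Δ ∷ x ∶ & As ∷ Λ ∷ []) →
    As [ j ]= A →
    Γ ⨾ Δ ⸴ x ∶ A ⊢ P ⦂ Λ →
    Γ ⨾ Δ ⸴ x ∶ & As ⊢ select x j P ⦂ Λ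

  copyR : ∀ {Γ Δ Λ P u A} →
    Distinct (Γ ∷ u ∶ A ∷ Δ ∷ Λ ∷ []) →
    (Γ ⸴ u ∶ A) ↑ ⨾ Δ ↑ ⊢ P ⦂ Λ ▸ A ^⊥ →
    Γ ⸴ u ∶ A ⨾ Δ ⊢ ν (send (suc u) zero P) ⦂ Λ

  copyL : ∀ {Γ Δ Λ P u A} →
    Distinct (Γ ∷ u ∶ A ∷ Δ ∷ Λ ∷ []) →
    (Γ ⸴ u ∶ A) ↑ ⨾ Δ ▸ A ⊢ P ⦂ Λ ↑ →
    Γ ⸴ u ∶ A ⨾ Δ ⊢ ν (send (suc u) zero P) ⦂ Λ

  !R : ∀ {Γ P x A} → Distinct (Γ ∷ x ∶ ! A ∷ []) →
    Γ ↑ ⨾ ∅ ⊢ P ⦂ ∅ ▸ A →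
    Γ ⨾ ∅ ⊢ serve x P ⦂ x ∶ ! A

  !L : ∀ {Γ Δ Λ P x A} → Distinct (Γ ∷ Δ ∷ x ∶ ! A ∷ Λ ∷ []) →
    Γ ▸ A ⨾ Δ ↑ ⊢ P ⦂ Λ ↑ →
    Γ ⨾ Δ ⸴ x ∶ ! A ⊢ P ⟨ x ⟩ ⦂ Λ

  ⁇R : ∀ {Γ Δ Λ P x A} → Distinct (Γ ∷ Δ ∷ Λ ∷ x ∶ ⁇ (A ^⊥) ∷ []) →
    Γ ▸ A ⨾ Δ ↑ ⊢ P ⦂ Λ ↑ →
    Γ ⨾ Δ ⊢ P ⟨ x ⟩ ⦂ Λ ⸴ x ∶ ⁇ (A ^⊥)

  ⁇L : ∀ {Γ P x A} → Distinct (Γ ∷ x ∶ ⁇ A ∷ []) →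
    Γ ↑ ⨾ ∅ ▸ A ⊢ P ⦂ ∅ →
    Γ ⨾ x ∶ ⁇ A ⊢ serve x P ⦂ ∅

  cutRL : ∀ {Γ Δ Δ′ Λ Λ′ P Q A} → Distinct (Γ ∷ Δ ∷ Δ′ ∷ Λ ∷ Λ′ ∷ []) →
    Γ ↑ ⨾ Δ ↑ ⊢ P ⦂ Λ ▸ A →
    Γ ↑ ⨾ Δ′ ▸ A ⊢ Q ⦂ Λ′ ↑ →
    Γ ⨾ Δ ⸴ Δ′ ⊢ ν (P ∣ Q) ⦂ Λ ⸴ Λ′

  cutLR : ∀ {Γ Δ Δ′ Λ Λ′ P Q A} → Distinct (Γ ∷ Δ ∷ Δ′ ∷ Λ ∷ Λ′ ∷ []) →
    Γ ↑ ⨾ Δ ▸ A ⊢ P ⦂ Λ ↑ →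
    Γ ↑ ⨾ Δ′ ↑ ⊢ Q ⦂ Λ′ ▸ A →
    Γ ⨾ Δ ⸴ Δ′ ⊢ ν (P ∣ Q) ⦂ Λ ⸴ Λ′

  cutRR : ∀ {Γ Δ Δ′ Λ Λ′ P Q A} → Distinct (Γ ∷ Δ ∷ Δ′ ∷ Λ ∷ Λ′ ∷ []) →
    Γ ↑ ⨾ Δ ↑ ⊢ P ⦂ Λ ▸ A →
    Γ ↑ ⨾ Δ′ ↑ ⊢ Q ⦂ Λ′ ▸ A ^⊥ →
    Γ ⨾ Δ ⸴ Δ′ ⊢ ν (P ∣ Q) ⦂ Λ ⸴ Λ′

  cutLL : ∀ {Γ Δ Δ′ Λ Λ′ P Q A} → Distinct (Γ ∷ Δ ∷ Δ′ ∷ Λ ∷ Λ′ ∷ []) →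
    Γ ↑ ⨾ Δ ▸ A ⊢ P ⦂ Λ ↑ →
    Γ ↑ ⨾ Δ′ ▸ A ^⊥ ⊢ Q ⦂ Λ′ ↑ →
    Γ ⨾ Δ ⸴ Δ′ ⊢ ν (P ∣ Q) ⦂ Λ ⸴ Λ′

  -- In the body of the server !u(x).Q (or !u(x).P) below, x is the name
  -- zero and u, which the typing premise does not assign, is suc zero.

  cut!R : ∀ {Γ Δ Λ P Q A} → Distinct (Γ ∷ Δ ∷ Λ ∷ []) →
    Γ ▸ A ⨾ Δ ↑ ⊢ P ⦂ Λ ↑ →
    Γ ↑ ↑ ⨾ ∅ ⊢ Q ⦂ ∅ ▸ A →
    Γ ⨾ Δ ⊢ ν (P ∣ serve zero Q) ⦂ Λ

  cut!L : ∀ {Γ Δ Λ P Q A} → Distinct (Γ ∷ Δ ∷ Λ ∷ []) →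
    Γ ↑ ↑ ⨾ ∅ ⊢ P ⦂ ∅ ▸ A →
    Γ ▸ A ⨾ Δ ↑ ⊢ Q ⦂ Λ ↑ →
    Γ ⨾ Δ ⊢ ν (serve zero P ∣ Q) ⦂ Λ

  cut?R : ∀ {Γ Δ Λ P Q A} → Distinct (Γ ∷ Δ ∷ Λ ∷ []) →
    Γ ▸ A ⨾ Δ ↑ ⊢ P ⦂ Λ ↑ →
    Γ ↑ ↑ ⨾ ∅ ▸ A ^⊥ ⊢ Q ⦂ ∅ →
    Γ ⨾ Δ ⊢ ν (P ∣ serve zero Q) ⦂ Λ

  cut?L : ∀ {Γ Δ Λ P Q A} → Distinct (Γ ∷ Δ ∷ Λ ∷ []) →
    Γ ↑ ↑ ⨾ ∅ ▸ A ^⊥ ⊢ P ⦂ ∅ →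
    Γ ▸ A ⨾ Δ ↑ ⊢ Q ⦂ Λ ↑ →
    Γ ⨾ Δ ⊢ ν (serve zero P ∣ Q) ⦂ Λ

{-# OPTIONS --safe #-}

-- The rules !L and ?R substitute a linear name for an unrestricted one and
-- apply to any process, so the last rule of a derivation does not follow from
-- the shape of the process.  But x is fresh there, so P{x/u} is just P with u
-- renamed to x, and both rules amount to opening: from some point on, a linear
-- x : !A (on the left) or x : ?A^⊥ (on the right) is an unrestricted x : A.
-- Typing is therefore equivalent to a syntax-directed system without
-- substitution, in which weakening and opening happen pointwise on the context
-- just before each rule.  There cut! and cut? are instances of the linear cut,
-- and the two sides of a cut stay put when cuts are rearranged.  For
-- νx(P|νy(Q|R)) ≡ νy(Q|νx(P|R)) it remains to redistribute the linear names
-- among P, Q and R; the other scope law follows from this one and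
-- commutativity.

module Submission where

open import Defs
open import Data.Fin.Base using (Fin; zero; suc; lift)
open import Data.Fin.Properties using (lift-injective; suc-injective; _≟_)
open import Data.List.Base as List using (List; []; _∷_; _++_)
open import Data.List.Relation.Unary.All as All using (All; []; _∷_)
open import Data.List.Relation.Unary.All.Properties using (++⁺; ++⁻ˡ; ++⁻ʳ)
open import Data.List.Relation.Unary.AllPairs using ([]; _∷_)
open import Data.Maybe using (Maybe; just; nothing; maybe; map; _<∣>_; Is-just)
open import Data.Maybe.Relation.Unary.Any using (just)
open import Data.Unit.Base using (tt)
open import Data.Vec.Base using ([]; _∷_; lookup; tabulate)
open import Data.Vec.Functional using (updateAt)
open import Data.Vec.Functional.Properties using (updateAt-updates; updateAt-minimal)
open import Data.Vec.Properties using
  (lookup-zipWith; lookup-replicate; lookup∘update; lookup∘update′;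
   lookup∘tabulate; tabulate∘lookup; tabulate-cong)
open import Data.Nat.Base using (ℕ; zero; suc; _+_)
open import Data.Nat.Properties using (+-suc) renaming (suc-injective to ℕ-suc-injective)
open import Data.Product.Base using (Σ; ∃; ∃-syntax; _×_; _,_; proj₁; proj₂)
open import Data.Sum.Base using (_⊎_; inj₁; inj₂)
open import Relation.Nullary using (Dec; yes; no; ¬_; contradiction)
open import Function.Base using (_∘_; id)
open import Function.Definitions using (Injective)
open import Relation.Binary.PropositionalEquality
  using (_≡_; _≢_; _≗_; refl; sym; trans; cong; cong₂; subst)

-- A single map from names to `none`, `unr` or `lin` replaces the three contexts. Distinctness of
-- names then holds by construction, and splitting, weakening and opening become relations between
-- single entries, so that redistributing names is a finite case analysis at each name. What makes
-- the scope laws delicate is that a name not free in a process may still be assigned in its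
-- context: it may be unrestricted, or linear but openable. Strengthening can therefore conclude
-- only that its entry leads to `none`. The price is paid on the way back to typing, which has no
-- weakening rule, opens one name at a time, and does so only for a process presented as `P ⟨ x ⟩`.
-- Weakening is thus pushed from the last rule into its premises. Opening leaves the process as it
-- is up to renaming, so the induction needs a second measure besides the process.

private variable
  m n k : ℕ

-- Renaming

lift-cong : {ρ σ : Fin m → Fin n} → ρ ≗ σ → lift 1 ρ ≗ lift 1 σ
lift-cong e zero    = refl
lift-cong e (suc i) = cong suc (e i)

mutual
  rename-cong : {ρ σ : Fin m → Fin n} → ρ ≗ σ → rename ρ ≗ rename σ
  rename-cong e 𝟎              = refl
  rename-cong e (ν P)          = cong ν (rename-cong (lift-cong e) P)
  rename-cong e (P ∣ Q)        = cong₂ _∣_ (rename-cong e P) (rename-cong e Q)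
  rename-cong e (send x y P)   rewrite e x | e y | rename-cong e P = refl
  rename-cong e (recv x P)     = cong₂ recv (e x) (rename-cong (lift-cong e) P)
  rename-cong e (select x j P) rewrite e x | rename-cong e P = refl
  rename-cong e (branch x Ps)  = cong₂ branch (e x) (renameAll-cong e Ps)
  rename-cong e (serve x P)    = cong₂ serve (e x) (rename-cong (lift-cong e) P)
  rename-cong e (fwd x y)      = cong₂ fwd (e x) (e y)
  rename-cong e (close x P)    = cong₂ close (e x) (rename-cong e P)
  rename-cong e (wait x P)     = cong₂ wait (e x) (rename-cong e P)

  renameAll-cong : {ρ σ : Fin m → Fin n} → ρ ≗ σ → renameAll ρ ≗ renameAll σ
  renameAll-cong e (last P)    = cong last (rename-cong e P)
  renameAll-cong e (cons P Ps) = cong₂ cons (rename-cong e P) (renameAll-cong e Ps)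
  renameAll-cong e (skip Ps)   = cong skip (renameAll-cong e Ps)

lift-∘ : {σ : Fin n → Fin k} {ρ : Fin m → Fin n} → lift 1 σ ∘ lift 1 ρ ≗ lift 1 (σ ∘ ρ)
lift-∘ zero    = refl
lift-∘ (suc i) = refl

mutual
  rename-∘ : {σ : Fin n → Fin k} {ρ : Fin m → Fin n} →
             rename σ ∘ rename ρ ≗ rename (σ ∘ ρ)
  rename-∘ 𝟎              = refl
  rename-∘ (ν P)          = cong ν (trans (rename-∘ P) (rename-cong lift-∘ P))
  rename-∘ (P ∣ Q)        = cong₂ _∣_ (rename-∘ P) (rename-∘ Q)
  rename-∘ (send x y P)   = cong (send _ _) (rename-∘ P)
  rename-∘ (recv x P)     = cong (recv _) (trans (rename-∘ P) (rename-cong lift-∘ P))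
  rename-∘ (select x j P) = cong (select _ j) (rename-∘ P)
  rename-∘ (branch x Ps)  = cong (branch _) (renameAll-∘ Ps)
  rename-∘ (serve x P)    = cong (serve _) (trans (rename-∘ P) (rename-cong lift-∘ P))
  rename-∘ (fwd x y)      = refl
  rename-∘ (close x P)    = cong (close _) (rename-∘ P)
  rename-∘ (wait x P)     = cong (wait _) (rename-∘ P)

  renameAll-∘ : {σ : Fin n → Fin k} {ρ : Fin m → Fin n} →
                renameAll σ ∘ renameAll ρ ≗ renameAll (σ ∘ ρ)
  renameAll-∘ (last P)    = cong last (rename-∘ P)
  renameAll-∘ (cons P Ps) = cong₂ cons (rename-∘ P) (renameAll-∘ Ps)
  renameAll-∘ (skip Ps)   = cong skip (renameAll-∘ Ps)

lift-id : {ρ : Fin n → Fin n} → ρ ≗ id → lift 1 ρ ≗ id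
lift-id e zero    = refl
lift-id e (suc i) = cong suc (e i)

mutual
  rename-id : {ρ : Fin n → Fin n} → ρ ≗ id → rename ρ ≗ id
  rename-id e 𝟎              = refl
  rename-id e (ν P)          = cong ν (rename-id (lift-id e) P)
  rename-id e (P ∣ Q)        = cong₂ _∣_ (rename-id e P) (rename-id e Q)
  rename-id e (send x y P)   rewrite e x | e y | rename-id e P = refl
  rename-id e (recv x P)     = cong₂ recv (e x) (rename-id (lift-id e) P)
  rename-id e (select x j P) rewrite e x | rename-id e P = refl
  rename-id e (branch x Ps)  = cong₂ branch (e x) (renameAll-id e Ps)
  rename-id e (serve x P)    = cong₂ serve (e x) (rename-id (lift-id e) P)
  rename-id e (fwd x y)      = cong₂ fwd (e x) (e y)
  rename-id e (close x P)    = cong₂ close (e x) (rename-id e P)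
  rename-id e (wait x P)     = cong₂ wait (e x) (rename-id e P)

  renameAll-id : {ρ : Fin n → Fin n} → ρ ≗ id → renameAll ρ ≗ id
  renameAll-id e (last P)    = cong last (rename-id e P)
  renameAll-id e (cons P Ps) = cong₂ cons (rename-id e P) (renameAll-id e Ps)
  renameAll-id e (skip Ps)   = cong skip (renameAll-id e Ps)

-- The syntax-directed system

data Lin : Set where
  left right : Type → Lin

data Entry : Set where
  none : Entry
  unr  : Type → Entry
  lin  : Lin → Entry

Cx : ℕ → Set
Cx n = Fin n → Entry

infixl 5 _∙_

_∙_ : Cx n → Entry → Cx (suc n)
(Θ ∙ e) zero    = e
(Θ ∙ e) (suc i) = Θ i

private variable
  A B : Type
  e e₁ e₂ e₃ f : Entry
  l o d : Lin
  Θ Θ₀ Θ₁ Θ₂ Θ′ : Cx n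
  x y : Fin n
  P Q : Proc n

data Open : Lin → Type → Set where
  !L : Open (left (! A)) A
  ⁇R : Open (right (⁇ (A ^⊥))) A

infix 4 _⇝_ _⇛_

-- `discard` is `open′` followed by `drop`. As a constructor of its own it makes the relation
-- transitive, so that consecutive weakenings and openings collapse into one step before a rule.
data _⇝_ : Entry → Entry → Set where
  keep    : e ⇝ e
  drop    : unr A ⇝ none
  open′   : Open l A → lin l ⇝ unr A
  discard : Open l A → lin l ⇝ none

_⇛_ : Cx n → Cx n → Set
Θ ⇛ Θ′ = ∀ i → Θ i ⇝ Θ′ i

data _≃_⋈_ : Entry → Entry → Entry → Set where
  none : none ≃ none ⋈ none
  unr  : unr A ≃ unr A ⋈ unr A
  linˡ : lin l ≃ lin l ⋈ none
  linʳ : lin l ≃ none ⋈ lin l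

Split : Cx n → Cx n → Cx n → Set
Split Θ Θ₁ Θ₂ = ∀ i → Θ i ≃ Θ₁ i ⋈ Θ₂ i

data Unr : Entry → Set where
  none : Unr none
  unr  : Unr (unr A)

AllUnr : Cx n → Set
AllUnr Θ = ∀ i → Unr (Θ i)

-- A relation rather than an update function: contexts are functions without extensionality, and
-- this pointwise form can be transported along renamings.
record Insert {n} (Θ₀ : Cx n) (x : Fin n) (e : Entry) (Θ : Cx n) : Set where
  constructor insert
  field
    fresh : Θ₀ x ≡ none
    at    : Θ x ≡ e
    off   : ∀ i → i ≢ x → Θ₀ i ≡ Θ i

open Insert

Add : Cx n → Fin n → Lin → Cx n → Set
Add Θ₀ x l Θ = Insert Θ₀ x (lin l) Θ

-- In Out l d o and In l d o, a name of type l is used to send or receive a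
-- name of type d, and continues with type o.

data Fwd : Lin → Lin → Set where
  idR : Fwd (left A) (right A)
  idL : Fwd (left A) (left (A ^⊥))

data Close : Lin → Set where
  𝟏R : Close (right 𝟏)
  ⊥L : Close (left ⊥)

data Wait : Lin → Set where
  𝟏L : Wait (left 𝟏)
  ⊥R : Wait (right ⊥)

data Out : Lin → Lin → Lin → Set where
  ⊗R : Out (right (A ⊗ B)) (right A) (right B)
  ⅋L : Out (left (A ⅋ B)) (left A) (left B)
  ⊸L : Out (left (A ⊸ B)) (right A) (left B)

data In : Lin → Lin → Lin → Set where
  ⊗L : In (left (A ⊗ B)) (left A) (left B)
  ⅋R : In (right (A ⅋ B)) (right A) (right B)
  ⊸R : In (right (A ⊸ B)) (left A) (right B)

data Select : Lin → Label → Lin → Set where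
  ⊕R : ∀ {As j} → As [ j ]= A → Select (right (⊕ As)) j (right A)
  &L : ∀ {As j} → As [ j ]= A → Select (left (& As)) j (left A)

data Branch : Lin → (Type → Lin) → Branches Type → Set where
  ⊕L : ∀ {As} → Branch (left (⊕ As)) left As
  &R : ∀ {As} → Branch (right (& As)) right As

data Copy : Type → Lin → Set where
  copyR : Copy A (right (A ^⊥))
  copyL : Copy A (left A)

data Serve : Lin → Lin → Set where
  !R : Serve (right (! A)) (right A)
  ⁇L : Serve (left (⁇ A)) (left A)

data Dual : Lin → Lin → Set where
  RL : Dual (right A) (left A)
  LR : Dual (left A) (right A)
  RR : Dual (right A) (right (A ^⊥))
  LL : Dual (left A) (left (A ^⊥))

infix 3 _⊢_ _⊢°_
infix 4 _▹_

mutual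
  data _⊢_ {n} (Θ : Cx n) (P : Proc n) : Set where
    _▹_ : Θ ⇛ Θ₀ → Θ₀ ⊢° P → Θ ⊢ P

  data _⊢°_ {n} : Cx n → Proc n → Set where
    fwd : Add Θ₀ x l Θ₁ → Add Θ₁ y o Θ → Fwd l o → AllUnr Θ₀ → Θ ⊢° fwd x y
    close : Add Θ₀ x l Θ → Close l → AllUnr Θ₀ → Θ ⊢° close x 𝟎
    wait : Add Θ₀ x l Θ → Wait l → Θ₀ ⊢ P → Θ ⊢° wait x P
    out : Add Θ₀ x l Θ → Split Θ₀ Θ₁ Θ₂ → Add Θ₂ x o Θ′ → Out l d o →
      Θ₁ ∙ lin d ⊢ P → Θ′ ∙ none ⊢ Q →
      Θ ⊢° ν (send (suc x) zero (P ∣ Q))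
    recv : Add Θ₀ x l Θ → Add Θ₀ x o Θ′ → In l d o →
      Θ′ ∙ lin d ⊢ P → Θ ⊢° recv x P
    select : ∀ {j} → Add Θ₀ x l Θ → Add Θ₀ x o Θ′ → Select l j o →
      Θ′ ⊢ P → Θ ⊢° select x j P
    branch : ∀ {s As Ps} → Add Θ₀ x l Θ → Branch l s As →
      Pointwise (λ A P → ∃[ Θ′ ] Add Θ₀ x (s A) Θ′ × (Θ′ ⊢ P)) As Ps →
      Θ ⊢° branch x Ps
    copy : Θ x ≡ unr A → Copy A d → Θ ∙ lin d ⊢ P →
      Θ ⊢° ν (send (suc x) zero P)
    serve : Add Θ₀ x l Θ → Serve l d → AllUnr Θ₀ → Θ₀ ∙ lin d ⊢ P →
      Θ ⊢° serve x P
    cut : Split Θ Θ₁ Θ₂ → Dual l o → Θ₁ ∙ lin l ⊢ P → Θ₂ ∙ lin o ⊢ Q →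
      Θ ⊢° ν (P ∣ Q)

-- Weakening and renaming in the syntax-directed system

⇝-trans : e₁ ⇝ e₂ → e₂ ⇝ e₃ → e₁ ⇝ e₃
⇝-trans keep      t    = t
⇝-trans drop      keep = drop
⇝-trans (open′ p) keep = open′ p
⇝-trans (open′ p) drop = discard p
⇝-trans (discard p) keep = discard p

≡⇒⇝ : e ≡ f → e ⇝ f
≡⇒⇝ refl = keep

weaken : Θ ⇛ Θ′ → Θ′ ⊢ P → Θ ⊢ P
weaken s (t ▹ D) = (λ i → ⇝-trans (s i) (t i)) ▹ D

exactly : Θ ⊢° P → Θ ⊢ P
exactly D = (λ _ → keep) ▹ D

∙-⇛ : Θ ⇛ Θ′ → e ⇝ f → Θ ∙ e ⇛ Θ′ ∙ f
∙-⇛ s t zero    = t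
∙-⇛ s t (suc i) = s i

none-⇝ : e ≡ none → e ⇝ f → f ≡ none
none-⇝ refl keep = refl

Unr-⇝none : Unr e → e ⇝ none
Unr-⇝none none = keep
Unr-⇝none unr  = drop

-- pull inv Θ is the image of Θ along ρ, given a partial inverse inv of ρ.  By
-- Cover, inv only has to invert ρ at the names used in Θ, so that ρ need not
-- be injective.

lift-inv : (Fin n → Maybe (Fin m)) → Fin (suc n) → Maybe (Fin (suc m))
lift-inv inv zero    = just zero
lift-inv inv (suc j) = map suc (inv j)

pull : (Fin n → Maybe (Fin m)) → Cx m → Cx n
pull inv Θ j = maybe Θ none (inv j)

record Inverse (ρ : Fin m → Fin n) (inv : Fin n → Maybe (Fin m)) : Set where
  constructor inverse
  field section : ∀ {i j} → inv j ≡ just i → ρ i ≡ j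

open Inverse

lift-inverse : {ρ : Fin m → Fin n} {inv : Fin n → Maybe (Fin m)} →
  Inverse ρ inv → Inverse (lift 1 ρ) (lift-inv inv)
lift-inverse {inv = inv} s .section {j = zero} refl = refl
lift-inverse {inv = inv} s .section {j = suc j} eq with inv j in eq′
lift-inverse {inv = inv} s .section {j = suc j} refl | just i =
  cong suc (s .section eq′)

Cover : (Fin m → Fin n) → (Fin n → Maybe (Fin m)) → Cx m → Set
Cover ρ inv Θ = ∀ i → Θ i ≡ none ⊎ inv (ρ i) ≡ just i

pull-⇛ : (inv : Fin n → Maybe (Fin m)) → Θ ⇛ Θ′ → pull inv Θ ⇛ pull inv Θ′
pull-⇛ inv s j with inv j
... | just i  = s i
... | nothing = keep

pull-∙ : (inv : Fin n → Maybe (Fin m)) →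
  pull inv Θ ∙ e ⇛ pull (lift-inv inv) (Θ ∙ e)
pull-∙ inv zero = keep
pull-∙ inv (suc j) with inv j
... | just i  = keep
... | nothing = keep

pull-Split : (inv : Fin n → Maybe (Fin m)) →
  Split Θ Θ₁ Θ₂ → Split (pull inv Θ) (pull inv Θ₁) (pull inv Θ₂)
pull-Split inv s j with inv j
... | just i  = s i
... | nothing = none

pull-Unr : (inv : Fin n → Maybe (Fin m)) → AllUnr Θ → AllUnr (pull inv Θ)
pull-Unr inv u j with inv j
... | just i  = u i
... | nothing = none

≃-none : e ≃ e₁ ⋈ e₂ → e ≡ none → e₁ ≡ none × e₂ ≡ none
≃-none none refl = refl , refl

module _ {ρ : Fin m → Fin n} {inv : Fin n → Maybe (Fin m)} (s : Inverse ρ inv) where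

  pull-Add : inv (ρ x) ≡ just x →
    Add Θ₀ x l Θ → Add (pull inv Θ₀) (ρ x) l (pull inv Θ)
  pull-Add eq a .fresh rewrite eq = a .fresh
  pull-Add eq a .at rewrite eq = a .at
  pull-Add eq a .off j j≢ with inv j in eq′
  ... | just i  = a .off i (λ i≡x → j≢ (trans (sym (s .section eq′)) (cong ρ i≡x)))
  ... | nothing = refl

  cover-∙ : Cover ρ inv Θ → Cover (lift 1 ρ) (lift-inv inv) (Θ ∙ e)
  cover-∙ c zero = inj₂ refl
  cover-∙ c (suc i) with c i
  ... | inj₁ p = inj₁ p
  ... | inj₂ p = inj₂ (cong (map suc) p)

  cover-⇛ : Θ ⇛ Θ′ → Cover ρ inv Θ → Cover ρ inv Θ′
  cover-⇛ t c i with c i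
  ... | inj₁ p = inj₁ (none-⇝ p (t i))
  ... | inj₂ p = inj₂ p

  cover-Split : Split Θ Θ₁ Θ₂ → Cover ρ inv Θ → Cover ρ inv Θ₁ × Cover ρ inv Θ₂
  cover-Split {Θ = Θ} {Θ₁} {Θ₂} t c =
    (λ i → go₁ i (c i)) , (λ i → go₂ i (c i))
    where
    go₁ : ∀ i → Θ i ≡ none ⊎ inv (ρ i) ≡ just i → Θ₁ i ≡ none ⊎ inv (ρ i) ≡ just i
    go₁ i (inj₁ p) = inj₁ (≃-none (t i) p .proj₁)
    go₁ i (inj₂ p) = inj₂ p
    go₂ : ∀ i → Θ i ≡ none ⊎ inv (ρ i) ≡ just i → Θ₂ i ≡ none ⊎ inv (ρ i) ≡ just i
    go₂ i (inj₁ p) = inj₁ (≃-none (t i) p .proj₂)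
    go₂ i (inj₂ p) = inj₂ p

  cover-Add : Add Θ₀ x l Θ → Cover ρ inv Θ → inv (ρ x) ≡ just x × Cover ρ inv Θ₀
  cover-Add {Θ₀ = Θ₀} {x = x} {Θ = Θ} a c = at-x (c x) , λ i → off-x i (i ≟ x) (c i)
    where
    at-x : Θ x ≡ none ⊎ inv (ρ x) ≡ just x → inv (ρ x) ≡ just x
    at-x (inj₁ p) with () ← trans (sym (a .at)) p
    at-x (inj₂ p) = p
    off-x : ∀ i → Dec (i ≡ x) → Θ i ≡ none ⊎ inv (ρ i) ≡ just i →
            Θ₀ i ≡ none ⊎ inv (ρ i) ≡ just i
    off-x i (yes refl) _        = inj₁ (a .fresh)
    off-x i (no i≢x)   (inj₁ p) = inj₁ (trans (a .off i i≢x) p)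
    off-x i (no i≢x)   (inj₂ p) = inj₂ p

  cover-Add′ : inv (ρ x) ≡ just x → Add Θ₀ x l Θ → Cover ρ inv Θ₀ → Cover ρ inv Θ
  cover-Add′ {x = x} eq a c i with i ≟ x | c i
  ... | yes refl | _      = inj₂ eq
  ... | no i≢x   | inj₁ p = inj₁ (trans (sym (a .off i i≢x)) p)
  ... | no i≢x   | inj₂ p = inj₂ p

mutual
  -- Apart from bound names, every name assigned in a premise is assigned in the conclusion, and
  -- `none` leads only to `none`. Hence `Cover` passes from the conclusion of each rule to its
  -- premises.
  rename-⊢ : {ρ : Fin m → Fin n} {inv : Fin n → Maybe (Fin m)} → Inverse ρ inv →
    Cover ρ inv Θ → Θ ⊢ P → pull inv Θ ⊢ rename ρ P
  rename-⊢ {inv = inv} s c (t ▹ D) = pull-⇛ inv t ▹ rename-⊢° s (cover-⇛ s t c) D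

  rename-∙-⊢ : {ρ : Fin m → Fin n} {inv : Fin n → Maybe (Fin m)} → Inverse ρ inv →
    Cover ρ inv Θ → Θ ∙ e ⊢ P → pull inv Θ ∙ e ⊢ rename (lift 1 ρ) P
  rename-∙-⊢ {inv = inv} s c D =
    weaken (pull-∙ inv) (rename-⊢ (lift-inverse s) (cover-∙ s c) D)

  rename-⊢° : {ρ : Fin m → Fin n} {inv : Fin n → Maybe (Fin m)} → Inverse ρ inv →
    Cover ρ inv Θ → Θ ⊢° P → pull inv Θ ⊢° rename ρ P
  rename-⊢° {inv = inv} s c (fwd a b r u) =
    let ey , c₁ = cover-Add s b c ; ex , c₀ = cover-Add s a c₁
    in fwd (pull-Add s ex a) (pull-Add s ey b) r (pull-Unr inv u)
  rename-⊢° {inv = inv} s c (close a r u) =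
    let ex , c₀ = cover-Add s a c
    in close (pull-Add s ex a) r (pull-Unr inv u)
  rename-⊢° s c (wait a r D) =
    let ex , c₀ = cover-Add s a c
    in wait (pull-Add s ex a) r (rename-⊢ s c₀ D)
  rename-⊢° {inv = inv} s c (out a t b r D E) =
    let ex , c₀ = cover-Add s a c ; c₁ , c₂ = cover-Split s t c₀
    in out (pull-Add s ex a) (pull-Split inv t) (pull-Add s ex b) r
           (rename-∙-⊢ s c₁ D) (rename-∙-⊢ s (cover-Add′ s ex b c₂) E)
  rename-⊢° s c (recv a b r D) =
    let ex , c₀ = cover-Add s a c
    in recv (pull-Add s ex a) (pull-Add s ex b) r (rename-∙-⊢ s (cover-Add′ s ex b c₀) D)
  rename-⊢° s c (select a b r D) =
    let ex , c₀ = cover-Add s a c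
    in select (pull-Add s ex a) (pull-Add s ex b) r (rename-⊢ s (cover-Add′ s ex b c₀) D)
  rename-⊢° s c (branch a r Ds) =
    let ex , c₀ = cover-Add s a c
    in branch (pull-Add s ex a) r (rename-branches s ex c₀ Ds)
  rename-⊢° {Θ = Θ} {ρ = ρ} {inv = inv} s c (copy {x = x} e r D) =
    copy (at-x (c x)) r (rename-∙-⊢ s c D)
    where
    at-x : Θ x ≡ none ⊎ inv (ρ x) ≡ just x → pull inv Θ (ρ x) ≡ unr _
    at-x (inj₁ p) with () ← trans (sym e) p
    at-x (inj₂ p) rewrite p = e
  rename-⊢° {inv = inv} s c (serve a r u D) =
    let ex , c₀ = cover-Add s a c
    in serve (pull-Add s ex a) r (pull-Unr inv u) (rename-∙-⊢ s c₀ D)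
  rename-⊢° {inv = inv} s c (cut t r D E) =
    let c₁ , c₂ = cover-Split s t c
    in cut (pull-Split inv t) r (rename-∙-⊢ s c₁ D) (rename-∙-⊢ s c₂ E)

  rename-branches : ∀ {ρ : Fin m → Fin n} {inv : Fin n → Maybe (Fin m)} {t : Type → Lin}
    {As Ps} → Inverse ρ inv → inv (ρ x) ≡ just x → Cover ρ inv Θ₀ →
    Pointwise (λ A P → ∃[ Θ ] Add Θ₀ x (t A) Θ × (Θ ⊢ P)) As Ps →
    Pointwise (λ A P → ∃[ Θ ] Add (pull inv Θ₀) (ρ x) (t A) Θ × (Θ ⊢ P)) As (renameAll ρ Ps)
  rename-branches s ex c (last (_ , a , D)) =
    last (_ , pull-Add s ex a , rename-⊢ s (cover-Add′ s ex a c) D)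
  rename-branches s ex c (cons (_ , a , D) Ds) =
    cons (_ , pull-Add s ex a , rename-⊢ s (cover-Add′ s ex a c) D) (rename-branches s ex c Ds)
  rename-branches s ex c (skip Ds) = skip (rename-branches s ex c Ds)

-- Strengthening: undoing an injective renaming

Outside : (Fin m → Fin n) → Cx n → Set
Outside ρ Θ = ∀ j → (∀ i → ρ i ≢ j) → Θ j ⇝ none

outside-lift : {ρ : Fin m → Fin n} → Outside (lift 1 ρ) (Θ ∙ e) → Outside ρ Θ
outside-lift u j j∉ = u (suc j) λ { zero () ; (suc i) refl → j∉ i refl }

outside-Unr : {ρ : Fin m → Fin n} → AllUnr Θ → Outside ρ Θ
outside-Unr u j _ = Unr-⇝none (u j)

module _ {ρ : Fin m → Fin n} where

  outside-Add : Add Θ₀ (ρ x) l Θ → Outside ρ Θ₀ → Outside ρ Θ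
  outside-Add {x = x} a u j j∉ = subst (_⇝ none) (a .off j λ { refl → j∉ x refl }) (u j j∉)

  outside-Add′ : Add Θ₀ (ρ x) l Θ → Outside ρ Θ → Outside ρ Θ₀
  outside-Add′ {x = x} a u j j∉ =
    subst (_⇝ none) (sym (a .off j λ { refl → j∉ x refl })) (u j j∉)

  outside-Split : Split Θ Θ₁ Θ₂ → Outside ρ Θ₁ → Outside ρ Θ₂ → Outside ρ Θ
  outside-Split s u₁ u₂ j j∉ = go (s j) (u₁ j j∉) (u₂ j j∉)
    where
    go : e ≃ e₁ ⋈ e₂ → e₁ ⇝ none → e₂ ⇝ none → e ⇝ none
    go none t u = t
    go unr  t u = t
    go linˡ t u = t
    go linʳ t u = u

  restrict-Add : Injective _≡_ _≡_ ρ → Add Θ₀ (ρ x) l Θ → Add (Θ₀ ∘ ρ) x l (Θ ∘ ρ)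
  restrict-Add inj a .fresh = a .fresh
  restrict-Add inj a .at = a .at
  restrict-Add inj a .off i i≢x = a .off _ (i≢x ∘ inj)

lift-inj : {ρ : Fin m → Fin n} → Injective _≡_ _≡_ ρ → Injective _≡_ _≡_ (lift 1 ρ)
lift-inj inj = lift-injective _ inj 1

mutual
  -- A name outside the image of `ρ` does not occur in `rename ρ P`, so no rule can act on it. At
  -- the leaves it is unrestricted or absent, and every step towards the root preserves that it can
  -- be discarded. Injectivity keeps other names from being sent to an inserted `ρ x`.
  unrename-⊢ : (P : Proc m) {ρ : Fin m → Fin n} → Injective _≡_ _≡_ ρ →
    Θ ⊢ rename ρ P → (Θ ∘ ρ ⊢ P) × Outside ρ Θ
  unrename-⊢ P {ρ} inj (s ▹ D) =
    let D′ , u = unrename-⊢° P inj D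
    in (s ∘ ρ ▹ D′) , λ j j∉ → ⇝-trans (s j) (u j j∉)

  unrename-∙-⊢ : (P : Proc (suc m)) {ρ : Fin m → Fin n} → Injective _≡_ _≡_ ρ →
    Θ ∙ e ⊢ rename (lift 1 ρ) P → ((Θ ∘ ρ) ∙ e ⊢ P) × Outside ρ Θ
  unrename-∙-⊢ {Θ = Θ} P {ρ} inj D =
    let D′ , u = unrename-⊢ P (lift-inj inj) D
    -- The two contexts agree only pointwise; weakening by `keep` everywhere stands in for
    -- extensionality, here and below.
    in weaken (λ { zero → keep ; (suc i) → keep }) D′ , outside-lift u

  unrename-⊢° : (P : Proc m) {ρ : Fin m → Fin n} → Injective _≡_ _≡_ ρ →
    Θ ⊢° rename ρ P → (Θ ∘ ρ ⊢° P) × Outside ρ Θ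
  unrename-⊢° (ν (P ∣ Q)) {ρ} inj (cut s r D E) =
    let D′ , u = unrename-∙-⊢ P inj D ; E′ , v = unrename-∙-⊢ Q inj E
    in cut (s ∘ ρ) r D′ E′ , outside-Split s u v
  unrename-⊢° (ν (send (suc x) zero (P ∣ Q))) {ρ} inj (out a s b r D E) =
    let D′ , u = unrename-∙-⊢ P inj D ; E′ , v = unrename-∙-⊢ Q inj E
    in out (restrict-Add inj a) (s ∘ ρ) (restrict-Add inj b) r D′ E′ ,
       outside-Add a (outside-Split s u (outside-Add′ b v))
  unrename-⊢° (ν (send (suc x) zero P)) inj (copy e r D) =
    let D′ , u = unrename-∙-⊢ P inj D in copy e r D′ , u
  unrename-⊢° (ν (send zero y P)) inj ()
  unrename-⊢° (ν (send (suc x) (suc y) P)) inj ()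
  unrename-⊢° (recv x P) inj (recv a b r D) =
    let D′ , u = unrename-∙-⊢ P inj D
    in recv (restrict-Add inj a) (restrict-Add inj b) r D′ ,
       outside-Add a (outside-Add′ b u)
  unrename-⊢° (select x j P) inj (select a b r D) =
    let D′ , u = unrename-⊢ P inj D
    in select (restrict-Add inj a) (restrict-Add inj b) r D′ ,
       outside-Add a (outside-Add′ b u)
  unrename-⊢° (branch x Ps) inj (branch a r Ds) =
    let Ds′ , u = unrename-branches Ps inj Ds
    in branch (restrict-Add inj a) r Ds′ , outside-Add a u
  unrename-⊢° (serve x P) inj (serve a r u D) =
    let D′ , _ = unrename-∙-⊢ P inj D
    in serve (restrict-Add inj a) r (u ∘ _) D′ , outside-Add a (outside-Unr u)
  unrename-⊢° (fwd x y) inj (fwd a b r u) =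
    fwd (restrict-Add inj a) (restrict-Add inj b) r (u ∘ _) ,
    outside-Add b (outside-Add a (outside-Unr u))
  unrename-⊢° (close x 𝟎) inj (close a r u) =
    close (restrict-Add inj a) r (u ∘ _) , outside-Add a (outside-Unr u)
  unrename-⊢° (wait x P) inj (wait a r D) =
    let D′ , u = unrename-⊢ P inj D
    in wait (restrict-Add inj a) r D′ , outside-Add a u

  -- Nonemptiness of the family matters here: the first branch alone shows that the names outside
  -- the image can be discarded.
  unrename-branches : ∀ {ρ : Fin m → Fin n} {t : Type → Lin} {As} (Ps : Branches (Proc m)) →
    Injective _≡_ _≡_ ρ →
    Pointwise (λ A P → ∃[ Θ ] Add Θ₀ (ρ x) (t A) Θ × (Θ ⊢ P)) As (renameAll ρ Ps) →
    Pointwise (λ A P → ∃[ Θ ] Add (Θ₀ ∘ ρ) x (t A) Θ × (Θ ⊢ P)) As Ps × Outside ρ Θ₀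
  unrename-branches (last P) inj (last (_ , a , D)) =
    let D′ , u = unrename-⊢ P inj D
    in last (_ , restrict-Add inj a , D′) , outside-Add′ a u
  unrename-branches (cons P Ps) inj (cons (_ , a , D) Ds) =
    let D′ , u = unrename-⊢ P inj D ; Ds′ , _ = unrename-branches Ps inj Ds
    in cons (_ , restrict-Add inj a , D′) Ds′ , outside-Add′ a u
  unrename-branches (skip Ps) inj (skip Ds) =
    let Ds′ , u = unrename-branches Ps inj Ds in skip Ds′ , u

-- Preservation of typing

^⊥-involutive : ∀ A → (A ^⊥) ^⊥ ≡ A
dualAll-involutive : ∀ As → dualAll (dualAll As) ≡ As
^⊥-involutive 𝟏       = refl
^⊥-involutive ⊥       = refl
^⊥-involutive (A ⊗ B) = cong (A ⊗_) (^⊥-involutive B)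
^⊥-involutive (A ⊸ B) = cong (A ⊸_) (^⊥-involutive B)
^⊥-involutive (⊕ As)  = cong ⊕_ (dualAll-involutive As)
^⊥-involutive (& As)  = cong &_ (dualAll-involutive As)
^⊥-involutive (! A)   = cong !_ (^⊥-involutive A)
^⊥-involutive (⁇ A)   = cong ⁇_ (^⊥-involutive A)
dualAll-involutive (last A)    = cong last (^⊥-involutive A)
dualAll-involutive (cons A As) = cong₂ cons (^⊥-involutive A) (dualAll-involutive As)
dualAll-involutive (skip As)   = cong skip (dualAll-involutive As)

Dual-sym : Dual l o → Dual o l
Dual-sym RL = LR
Dual-sym LR = RL
Dual-sym (RR {A}) = subst (λ B → Dual (right (A ^⊥)) (right B)) (^⊥-involutive A) RR
Dual-sym (LL {A}) = subst (λ B → Dual (left (A ^⊥)) (left B)) (^⊥-involutive A) LL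

-- _≃_⋈_ with weakening and opening before and after.

data Share (e : Entry) : Entry → Entry → Set where
  inl  : e ⇝ f → Share e f none
  inr  : e ⇝ f → Share e none f
  both : e ⇝ unr A → Share e (unr A) (unr A)

⋈-share : e ⇝ e₁ → e₁ ≃ e₂ ⋈ e₃ → Share e e₂ e₃
⋈-share s none = inl s
⋈-share s unr  = both s
⋈-share s linˡ = inl s
⋈-share s linʳ = inr s

-- All openings can be moved before the split, because an unrestricted entry is copied to both
-- sides; after the split only `drop` is ever needed, on a side that does not want the copy.
share-⋈ : Share e e₁ e₂ →
  Σ (Entry × Entry × Entry) λ (f , f₁ , f₂) → e ⇝ f × f ≃ f₁ ⋈ f₂ × f₁ ⇝ e₁ × f₂ ⇝ e₂
share-⋈ (inl {none} s)  = _ , s , none , keep , keep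
share-⋈ (inl {unr _} s) = _ , s , unr , keep , drop
share-⋈ (inl {lin _} s) = _ , s , linˡ , keep , keep
share-⋈ (inr {none} s)  = _ , s , none , keep , keep
share-⋈ (inr {unr _} s) = _ , s , unr , drop , keep
share-⋈ (inr {lin _} s) = _ , s , linʳ , keep , keep
share-⋈ (both s)        = _ , s , unr , keep , keep

share-sym : Share e e₁ e₂ → Share e e₂ e₁
share-sym (inl s)  = inr s
share-sym (inr s)  = inl s
share-sym (both s) = both s

-- Here `e₁`, `e₃` and `e₄` are the entries for P, Q and R, and `f` is what P and R need between
-- them. A linear entry reaches only one of the three; as soon as two need the name, it has been
-- opened already where they separate, and opening it at the root serves every grouping.
share-assoc-comm : ∀ {e₄} → Share e e₁ e₂ → Share e₂ e₃ e₄ →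
  ∃[ f ] Share e e₃ f × Share f e₁ e₄
share-assoc-comm (inl s)  (inl keep)  = _ , inr s , inl keep
share-assoc-comm (inl s)  (inr keep)  = _ , inr s , inl keep
share-assoc-comm (inr s)  (inl t)     = _ , inl (⇝-trans s t) , inl keep
share-assoc-comm (inr s)  (inr t)     = _ , inr (⇝-trans s t) , inr keep
share-assoc-comm (inr s)  (both t)    = _ , both (⇝-trans s t) , inr keep
share-assoc-comm (both s) (inl keep)  = _ , both s , inl keep
share-assoc-comm (both s) (inl drop)  = _ , inr s , inl keep
share-assoc-comm (both s) (inr keep)  = _ , inr s , both keep
share-assoc-comm (both s) (inr drop)  = _ , inr s , inl keep
share-assoc-comm (both s) (both keep) = _ , both s , both keep

share-unusedˡ : Share e e₁ e₂ → e₁ ⇝ none → e ⇝ e₂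
share-unusedˡ (inl s)  t = ⇝-trans s t
share-unusedˡ (inr s)  t = s
share-unusedˡ (both s) t = s

record Cut (Θ : Cx n) (P Q : Proc (suc n)) : Set where
  constructor shared
  field
    {Θˡ Θʳ} : Cx n
    {tˡ tʳ} : Lin
    shares  : ∀ i → Share (Θ i) (Θˡ i) (Θʳ i)
    dual    : Dual tˡ tʳ
    typedˡ  : Θˡ ∙ lin tˡ ⊢ P
    typedʳ  : Θʳ ∙ lin tʳ ⊢ Q

uncut : Θ ⊢ ν (P ∣ Q) → Cut Θ P Q
uncut (s ▹ cut t r D E) = shared (λ i → ⋈-share (s i) (t i)) r D E

recut : Cut Θ P Q → Θ ⊢ ν (P ∣ Q)
recut (shared t r D E) =
  (λ i → share-⋈ (t i) .proj₂ .proj₁) ▹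
  cut (λ i → share-⋈ (t i) .proj₂ .proj₂ .proj₁) r
      (weaken (∙-⇛ (λ i → share-⋈ (t i) .proj₂ .proj₂ .proj₂ .proj₁) keep) D)
      (weaken (∙-⇛ (λ i → share-⋈ (t i) .proj₂ .proj₂ .proj₂ .proj₂) keep) E)

comm-⊢ : Θ ⊢ ν (P ∣ Q) → Θ ⊢ ν (Q ∣ P)
comm-⊢ D with uncut D
... | shared t r D E = recut (shared (share-sym ∘ t) (Dual-sym r) E D)

wk-injective : Injective _≡_ _≡_ (lift 1 (suc {n}))
wk-injective = lift-injective suc suc-injective 1

wk-inv : Fin (suc (suc n)) → Maybe (Fin (suc n))
wk-inv = lift-inv λ { zero → nothing ; (suc i) → just i }

wk-inverse : Inverse {n = suc (suc n)} (lift 1 suc) wk-inv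
wk-inverse = lift-inverse λ where .section {j = suc j} refl → refl

wk-⊢ : Θ ∙ e ⊢ P → Θ ∙ none ∙ e ⊢ wk P
wk-⊢ D = weaken (λ { zero → keep ; (suc zero) → keep ; (suc (suc i)) → keep })
  (rename-⊢ wk-inverse (λ { zero → inj₂ refl ; (suc i) → inj₂ refl }) D)

wk-⊢⁻ : Θ ∙ f ∙ e ⊢ wk P → (Θ ∙ e ⊢ P) × f ⇝ none
wk-⊢⁻ {P = P} D =
  let D′ , u = unrename-⊢ P wk-injective D
  in weaken (λ { zero → keep ; (suc i) → keep }) D′ ,
     u (suc zero) λ { zero () ; (suc i) () }

swap-involutive : (i : Fin (suc (suc n))) → swap (swap i) ≡ i
swap-involutive zero          = refl
swap-involutive (suc zero)    = refl
swap-involutive (suc (suc i)) = refl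

swap-⊢ : Θ ∙ e ∙ f ⊢ P → Θ ∙ f ∙ e ⊢ rename swap P
swap-⊢ D = weaken (λ { zero → keep ; (suc zero) → keep ; (suc (suc i)) → keep })
  (rename-⊢ {inv = just ∘ swap} (λ where .section {j = j} refl → swap-involutive j)
            (λ i → inj₂ (cong just (swap-involutive i))) D)

-- The derivation may pass x to Q, where it is not free.  Then x must have been
-- openable (!A on the left or ?A on the right), and R may have it instead.

assoc-comm-⊢ : ∀ {Q R} → Θ ⊢ ν (P ∣ ν (wk Q ∣ R)) → Θ ⊢ ν (Q ∣ ν (wk P ∣ rename swap R))
assoc-comm-⊢ {P = P} {Q} {R} D with uncut D
... | shared t r DP DQR with uncut DQR
... | shared {Θ₃} {Θ₄} t′ r′ DQ DR =
  let split i = share-assoc-comm (t i) (t′ (suc i))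
      DQ′ , u = wk-⊢⁻ {P = Q}
        (weaken (λ { zero → keep ; (suc zero) → keep ; (suc (suc i)) → keep }) DQ)
      DR′ = weaken {Θ′ = Θ₄ ∙ _}
        (λ { zero → keep ; (suc zero) → share-unusedˡ (t′ zero) u ; (suc (suc i)) → keep }) DR
  in recut (shared (λ i → split i .proj₂ .proj₁) r′ DQ′
       (recut (shared
          -- Index `zero` is y, now restricted outside x. It goes to R alone, as P was never in its
          -- scope.
          (λ { zero → inr keep ; (suc i) → split i .proj₂ .proj₂ })
          r (wk-⊢ DP) (swap-⊢ DR′))))

-- Some subterms of typed processes are not typed on their own: parallel
-- compositions and outputs occur below a restriction, and 𝟎 below an empty
-- send.  Frames add just enough around a process to reach a typed one.

data Frame : ℕ → ℕ → Set where
  hole  : Frame n n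
  ν     : Frame (suc n) n
  close : Fin n → Frame n n
  νsend : (x y : Fin (suc n)) → Frame (suc n) n

plug : Frame m n → Proc m → Proc n
plug hole        P = P
plug ν           P = ν P
plug (close x)   P = close x P
plug (νsend x y) P = ν (send x y P)

infix 4 _⊑_

_⊑_ : Proc m → Proc m → Set
_⊑_ {m} P Q = ∀ {n} (F : Frame m n) {Θ : Cx n} → Θ ⊢ plug F P → Θ ⊢ plug F Q

data Guarded {n} : Proc n → Set where
  ν      : ∀ {P} → Guarded (ν P)
  recv   : ∀ {P} → Guarded (recv x P)
  select : ∀ {j P} → Guarded (select x j P)
  branch : ∀ {Ps} → Guarded (branch x Ps)
  serve  : ∀ {P} → Guarded (serve x P)
  close  : ∀ {P} → Guarded (close x P)
  wait   : ∀ {P} → Guarded (wait x P)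

-- The typing rules for `ν` demand a composition or a send below it, and those for an empty send
-- demand `𝟎`. None of these is guarded, so a guarded process can stand only in the hole or as the
-- continuation of a `copy`, and there it is typed on its own.
guarded-⊑ : {P Q : Proc n} → Guarded P → (∀ {Θ} → Θ ⊢ P → Θ ⊢ Q) → P ⊑ Q
guarded-⊑ g f hole D = f D
guarded-⊑ () f ν (_ ▹ cut _ _ _ _)
guarded-⊑ () f ν (_ ▹ out _ _ _ _ _ _)
guarded-⊑ () f ν (_ ▹ copy _ _ _)
guarded-⊑ g f (νsend x y) (s ▹ copy e r D) = s ▹ copy e r (f D)
guarded-⊑ () f (close x) (_ ▹ close _ _ _)
guarded-⊑ () f (νsend x y) (_ ▹ out _ _ _ _ _ _)

∣-⊑ : {P P′ Q Q′ : Proc n} → P ⊑ P′ → Q ⊑ Q′ → P ∣ Q ⊑ P′ ∣ Q′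
∣-⊑ p q hole (_ ▹ ())
∣-⊑ p q ν (s ▹ cut t r D E) = s ▹ cut t r (p hole D) (q hole E)
∣-⊑ p q (νsend x y) (s ▹ out a t b r D E) = s ▹ out a t b r (p hole D) (q hole E)
∣-⊑ p q (νsend x y) (s ▹ copy e r (_ ▹ ()))

send-⊑ : {P Q : Proc n} → P ⊑ Q → send x y P ⊑ send x y Q
send-⊑ p hole (_ ▹ ())
send-⊑ p ν D = p (νsend _ _) D
send-⊑ p (νsend x y) (s ▹ copy e r (_ ▹ ()))

ν-⊑ : {P Q : Proc (suc n)} → P ⊑ Q → ν P ⊑ ν Q
ν-⊑ p = guarded-⊑ ν (p ν)

recv-⊑ : {P Q : Proc (suc n)} → P ⊑ Q → recv x P ⊑ recv x Q
recv-⊑ p = guarded-⊑ recv λ { (s ▹ recv a b r D) → s ▹ recv a b r (p hole D) }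

select-⊑ : ∀ {j} {P Q : Proc n} → P ⊑ Q → select x j P ⊑ select x j Q
select-⊑ p = guarded-⊑ select λ { (s ▹ select a b r D) → s ▹ select a b r (p hole D) }

serve-⊑ : {P Q : Proc (suc n)} → P ⊑ Q → serve x P ⊑ serve x Q
serve-⊑ p = guarded-⊑ serve λ { (s ▹ serve a r u D) → s ▹ serve a r u (p hole D) }

wait-⊑ : {P Q : Proc n} → P ⊑ Q → wait x P ⊑ wait x Q
wait-⊑ p = guarded-⊑ wait λ { (s ▹ wait a r D) → s ▹ wait a r (p hole D) }

branch-⊑ : ∀ {Ps Qs : Branches (Proc n)} → Pointwise _⊑_ Ps Qs → branch x Ps ⊑ branch x Qs
branch-⊑ {n} {x} ps =
  guarded-⊑ branch λ { (s ▹ branch a r Ds) → s ▹ branch a r (go ps Ds) }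
  where
  go : ∀ {Θ₀ : Cx n} {t : Type → Lin} {As Ps Qs} → Pointwise _⊑_ Ps Qs →
    Pointwise (λ A P → ∃[ Θ ] Add Θ₀ x (t A) Θ × (Θ ⊢ P)) As Ps →
    Pointwise (λ A P → ∃[ Θ ] Add Θ₀ x (t A) Θ × (Θ ⊢ P)) As Qs
  go (last p)    (last (_ , a , D))    = last (_ , a , p hole D)
  go (cons p ps) (cons (_ , a , D) Ds) = cons (_ , a , p hole D) (go ps Ds)
  go (skip ps)   (skip Ds)             = skip (go ps Ds)

close-⊑ : {P Q : Proc n} → P ⊑ Q → close x P ⊑ close x Q
close-⊑ p = guarded-⊑ close (p (close _))

comm-⊑ : {P Q : Proc (suc n)} → ν (P ∣ Q) ⊑ ν (Q ∣ P)
comm-⊑ = guarded-⊑ ν comm-⊢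

assoc-comm-⊑ : {P Q : Proc (suc n)} {R : Proc (suc (suc n))} →
  ν (P ∣ ν (wk Q ∣ R)) ⊑ ν (Q ∣ ν (wk P ∣ rename swap R))
assoc-comm-⊑ = guarded-⊑ ν assoc-comm-⊢

rename-swap-involutive : (P : Proc (suc (suc n))) → rename swap (rename swap P) ≡ P
rename-swap-involutive P = trans (rename-∘ P) (rename-id swap-involutive P)

assoc-⊑ : {P R : Proc (suc n)} {Q : Proc (suc (suc n))} →
  ν (P ∣ ν (Q ∣ wk R)) ⊑ ν (ν (wk P ∣ rename swap Q) ∣ R)
assoc-⊑ {P = P} {R} {Q} F D =
  comm-⊑ F (assoc-comm-⊑ {P = P} {R} {Q} F (ν-⊑ (∣-⊑ (λ _ D → D) comm-⊑) F D))

assoc-⊒ : {P R : Proc (suc n)} {Q : Proc (suc (suc n))} →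
  ν (ν (wk P ∣ rename swap Q) ∣ R) ⊑ ν (P ∣ ν (Q ∣ wk R))
assoc-⊒ {P = P} {R} {Q} F D =
  ν-⊑ (∣-⊑ (λ _ D → D) comm-⊑) F
    (subst (λ Q → _ ⊢ plug F (ν (P ∣ ν (wk R ∣ Q)))) (rename-swap-involutive Q)
      (assoc-comm-⊑ {P = R} {P} F (comm-⊑ F D)))

-- The law is its own converse with P and Q exchanged, once the two swaps of R cancel.
assoc-comm-⊒ : {P Q : Proc (suc n)} {R : Proc (suc (suc n))} →
  ν (Q ∣ ν (wk P ∣ rename swap R)) ⊑ ν (P ∣ ν (wk Q ∣ R))
assoc-comm-⊒ {P = P} {Q} {R} F D =
  subst (λ R → _ ⊢ plug F (ν (P ∣ ν (wk Q ∣ R)))) (rename-swap-involutive R)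
    (assoc-comm-⊑ {P = Q} {P} F D)

-- Induction over structural congruence

mutual
  -- Since `_⊑_` is directed, `≅-sym` forces both directions to be proved together.
  ≅⇒⊑ : {P Q : Proc n} → P ≅ Q → P ⊑ Q
  ≅⇒⊑ comm          = comm-⊑
  ≅⇒⊑ (assoc-comm {P} {Q}) = assoc-comm-⊑ {P = P} {Q}
  ≅⇒⊑ (assoc {P} {Q} {R}) = assoc-⊑ {P = P} {R} {Q}
  ≅⇒⊑ ≅-refl        = λ _ D → D
  ≅⇒⊑ (≅-sym p)     = ≅⇒⊒ p
  ≅⇒⊑ (≅-trans p q) = λ F → ≅⇒⊑ q F ∘ ≅⇒⊑ p F
  ≅⇒⊑ (ν p)         = ν-⊑ (≅⇒⊑ p)
  ≅⇒⊑ (p ∣ q)       = ∣-⊑ (≅⇒⊑ p) (≅⇒⊑ q)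
  ≅⇒⊑ (send p)      = send-⊑ (≅⇒⊑ p)
  ≅⇒⊑ (recv p)      = recv-⊑ (≅⇒⊑ p)
  ≅⇒⊑ (select p)    = select-⊑ (≅⇒⊑ p)
  ≅⇒⊑ (branch ps)   = branch-⊑ (≅⇒⊑-all ps)
  ≅⇒⊑ (serve p)     = serve-⊑ (≅⇒⊑ p)
  ≅⇒⊑ (close p)     = close-⊑ (≅⇒⊑ p)
  ≅⇒⊑ (wait p)      = wait-⊑ (≅⇒⊑ p)

  ≅⇒⊒ : {P Q : Proc n} → P ≅ Q → Q ⊑ P
  ≅⇒⊒ comm          = comm-⊑
  ≅⇒⊒ (assoc-comm {P} {Q} {R}) = assoc-comm-⊒ {P = P} {Q} {R}
  ≅⇒⊒ (assoc {P} {Q} {R}) = assoc-⊒ {P = P} {R} {Q}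
  ≅⇒⊒ ≅-refl        = λ _ D → D
  ≅⇒⊒ (≅-sym p)     = ≅⇒⊑ p
  ≅⇒⊒ (≅-trans p q) = λ F → ≅⇒⊒ p F ∘ ≅⇒⊒ q F
  ≅⇒⊒ (ν p)         = ν-⊑ (≅⇒⊒ p)
  ≅⇒⊒ (p ∣ q)       = ∣-⊑ (≅⇒⊒ p) (≅⇒⊒ q)
  ≅⇒⊒ (send p)      = send-⊑ (≅⇒⊒ p)
  ≅⇒⊒ (recv p)      = recv-⊑ (≅⇒⊒ p)
  ≅⇒⊒ (select p)    = select-⊑ (≅⇒⊒ p)
  ≅⇒⊒ (branch ps)   = branch-⊑ (≅⇒⊒-all ps)
  ≅⇒⊒ (serve p)     = serve-⊑ (≅⇒⊒ p)
  ≅⇒⊒ (close p)     = close-⊑ (≅⇒⊒ p)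
  ≅⇒⊒ (wait p)      = wait-⊑ (≅⇒⊒ p)

  ≅⇒⊑-all : {Ps Qs : Branches (Proc n)} → Pointwise _≅_ Ps Qs → Pointwise _⊑_ Ps Qs
  ≅⇒⊑-all (last p)    = last (≅⇒⊑ p)
  ≅⇒⊑-all (cons p ps) = cons (≅⇒⊑ p) (≅⇒⊑-all ps)
  ≅⇒⊑-all (skip ps)   = skip (≅⇒⊑-all ps)

  ≅⇒⊒-all : {Ps Qs : Branches (Proc n)} → Pointwise _≅_ Ps Qs → Pointwise _⊑_ Qs Ps
  ≅⇒⊒-all (last p)    = last (≅⇒⊒ p)
  ≅⇒⊒-all (cons p ps) = cons (≅⇒⊒ p) (≅⇒⊒-all ps)
  ≅⇒⊒-all (skip ps)   = skip (≅⇒⊒-all ps)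

-- Contexts, pointwise

private variable
  Γ Δ Δ′ Λ Λ′ : Ctx n
  cs ds : List (Ctx n)

ctx-ext : lookup Γ ≗ lookup Δ → Γ ≡ Δ
ctx-ext {Γ = Γ} {Δ} eq =
  trans (sym (tabulate∘lookup Γ)) (trans (tabulate-cong eq) (tabulate∘lookup Δ))

∅-fresh : {x : Fin n} → lookup ∅ x ≡ nothing
∅-fresh {x = x} = lookup-replicate x nothing

∶-at : (x : Fin n) → lookup (x ∶ A) x ≡ just A
∶-at x = lookup∘update x ∅ _

∶-off : y ≢ x → lookup (x ∶ A) y ≡ nothing
∶-off {y = y} y≢x = trans (lookup∘update′ y≢x ∅ _) (∅-fresh {x = y})

<∣>-nothing : ∀ {S : Set} (s : Maybe S) → (s <∣> nothing) ≡ s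
<∣>-nothing (just _) = refl
<∣>-nothing nothing  = refl

⸴-fresh : lookup Γ x ≡ nothing → lookup Δ x ≡ nothing → lookup (Γ ⸴ Δ) x ≡ nothing
⸴-fresh {Γ = Γ} {x} {Δ} p q rewrite lookup-zipWith _<∣>_ x Γ Δ | p | q = refl

⸴∶-at : lookup Γ x ≡ nothing → lookup (Γ ⸴ x ∶ A) x ≡ just A
⸴∶-at {Γ = Γ} {x} {A} p
  rewrite lookup-zipWith _<∣>_ x Γ (x ∶ A) | p = ∶-at x

⸴∶-off : y ≢ x → lookup (Γ ⸴ x ∶ A) y ≡ lookup Γ y
⸴∶-off {y = y} {x} {Γ} {A} y≢x
  rewrite lookup-zipWith _<∣>_ y Γ (x ∶ A) | ∶-off {A = A} y≢x = <∣>-nothing _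

⸴-identityˡ : (Γ : Ctx n) → ∅ ⸴ Γ ≡ Γ
⸴-identityˡ []      = refl
⸴-identityˡ (_ ∷ Γ) = cong (_ ∷_) (⸴-identityˡ Γ)

¬just⇒nothing : {s : Maybe Type} → ¬ Is-just s → s ≡ nothing
¬just⇒nothing {just _}  p = contradiction (just tt) p
¬just⇒nothing {nothing} p = refl

¬nothing-just : {s : Maybe Type} → s ≡ nothing → ¬ Is-just s
¬nothing-just refl ()

disjoint-sym : (Γ Δ : Ctx n) → Disjoint Γ Δ → Disjoint Δ Γ
disjoint-sym _ _ d i (p , q) = d i (q , p)

disjoint⇒fresh : (c : Ctx n) → Disjoint c (x ∶ A) → lookup c x ≡ nothing
disjoint⇒fresh {x = x} {A} c d =
  ¬just⇒nothing λ p → d x (p , subst Is-just (sym (∶-at {A = A} x)) (just tt))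

fresh⇒disjoint : (c : Ctx n) → lookup c x ≡ nothing → Disjoint c (x ∶ A)
fresh⇒disjoint {x = x} c p i (q , r) with i ≟ x
... | yes refl = ¬nothing-just p q
... | no i≢x   = ¬nothing-just (∶-off i≢x) r

remove-∶ : ∀ (cs : List (Ctx n)) {ds x A} → Distinct (cs ++ x ∶ A ∷ ds) →
  Distinct (cs ++ ds) × All (λ c → lookup c x ≡ nothing) (cs ++ ds)
remove-∶ [] {x = x} {A} (p ∷ d) =
  d , All.map (λ {c} → disjoint⇒fresh {x = x} {A} c ∘ disjoint-sym (x ∶ A) c) p
remove-∶ (c ∷ cs) {x = x} (p ∷ d) with ++⁻ʳ cs p | remove-∶ cs d
... | q ∷ r | d′ , f = (++⁺ (++⁻ˡ cs p) r ∷ d′) , (disjoint⇒fresh {x = x} c q ∷ f)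

insert-∶ : ∀ (cs : List (Ctx n)) {ds x A} → Distinct (cs ++ ds) →
  All (λ c → lookup c x ≡ nothing) (cs ++ ds) → Distinct (cs ++ x ∶ A ∷ ds)
insert-∶ [] {x = x} {A} d f =
  All.map (λ {c} → disjoint-sym c (x ∶ A) ∘ fresh⇒disjoint c) f ∷ d
insert-∶ (c ∷ cs) (p ∷ d) (q ∷ f) =
  ++⁺ (++⁻ˡ cs p) (fresh⇒disjoint c q ∷ ++⁻ʳ cs p) ∷ insert-∶ cs d f

-- The trace of `Distinct` at one name. It turns equations between combinations of contexts into
-- case analyses on which context, if any, assigns that name.
data AtMostOne : List (Maybe Type) → Set where
  []      : AtMostOne []
  nothing : ∀ {ms} → AtMostOne ms → AtMostOne (nothing ∷ ms)
  just    : ∀ {ms} → All (_≡ nothing) ms → AtMostOne (just A ∷ ms)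

Apart : List (Ctx n) → Set
Apart cs = ∀ i → AtMostOne (List.map (λ c → lookup c i) cs)

distinct⇒apart : Distinct cs → Apart cs
distinct⇒apart []      i = []
distinct⇒apart {cs = c ∷ cs} (p ∷ d) i with lookup c i in eq
... | nothing = nothing (distinct⇒apart d i)
... | just A  = just (go p)
  where
  go : All (Disjoint c) ds → All (_≡ nothing) (List.map (λ c → lookup c i) ds)
  go []      = []
  go (p ∷ q) = ¬just⇒nothing (λ r → p i (subst Is-just (sym eq) (just tt) , r)) ∷ go q

apart⇒distinct : (cs : List (Ctx n)) → Apart cs → Distinct cs
apart⇒distinct []       a = []
apart⇒distinct (c ∷ cs) a = go cs a ∷ apart⇒distinct cs (λ i → tail (a i))
  where
  tail : ∀ {m ms} → AtMostOne (m ∷ ms) → AtMostOne ms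
  tail (nothing a)     = a
  tail (just [])       = []
  -- `𝟏` is a placeholder: the recursion needs some assigned head in front of the remaining
  -- `nothing` entries.
  tail (just (refl ∷ p)) = nothing (tail (just {𝟏} p))
  second : ∀ {m₁ m₂ ms} → AtMostOne (m₁ ∷ m₂ ∷ ms) → AtMostOne (m₁ ∷ ms)
  second (nothing a)    = nothing (tail a)
  second (just (_ ∷ p)) = just p
  clash : ∀ {m₁ m₂ ms} → AtMostOne (m₁ ∷ m₂ ∷ ms) → ¬ (Is-just m₁ × Is-just m₂)
  clash (nothing a) (() , _)
  clash (just (p ∷ _)) (_ , q) = ¬nothing-just p q
  go : ∀ ds → Apart (c ∷ ds) → All (Disjoint c) ds
  go []       a = []
  go (d ∷ ds) a = (λ i → clash (a i)) ∷ go ds (λ i → second (a i))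

-- From typing to the syntax-directed system

-- Priorities make the function total. For distinct contexts at most one argument is `just`, and
-- then all three can be recovered from the result.
entry : Maybe Type → Maybe Type → Maybe Type → Entry
entry (just A) _        _        = unr A
entry nothing  (just A) _        = lin (left A)
entry nothing  nothing  (just A) = lin (right A)
entry nothing  nothing  nothing  = none

merge : Ctx n → Ctx n → Ctx n → Cx n
merge Γ Δ Λ i = entry (lookup Γ i) (lookup Δ i) (lookup Λ i)

merge-fresh : lookup Γ x ≡ nothing → lookup Δ x ≡ nothing → lookup Λ x ≡ nothing →
  merge Γ Δ Λ x ≡ none
merge-fresh p q r rewrite p | q | r = refl

merge-unr : AllUnr (merge Γ ∅ ∅)
merge-unr {Γ = Γ} i with lookup Γ i
... | just _  = unr
... | nothing rewrite ∅-fresh {x = i} = none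

merge-Addˡ : lookup Γ x ≡ nothing → lookup Δ x ≡ nothing → lookup Λ x ≡ nothing →
  Add (merge Γ Δ Λ) x (left A) (merge Γ (Δ ⸴ x ∶ A) Λ)
merge-Addˡ {Γ = Γ} {Δ = Δ} {Λ = Λ} p q r .fresh = merge-fresh {Γ = Γ} {Δ = Δ} {Λ = Λ} p q r
merge-Addˡ {x = x} {Δ = Δ} {A = A} p q r .at
  rewrite ⸴∶-at {Γ = Δ} {x} {A} q | p = refl
merge-Addˡ {x = x} {Δ = Δ} {A = A} p q r .off i i≢x
  rewrite ⸴∶-off {y = i} {x} {Δ} {A} i≢x = refl

merge-Addʳ : lookup Γ x ≡ nothing → lookup Δ x ≡ nothing → lookup Λ x ≡ nothing →
  Add (merge Γ Δ Λ) x (right A) (merge Γ Δ (Λ ⸴ x ∶ A))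
merge-Addʳ {Γ = Γ} {Δ = Δ} {Λ = Λ} p q r .fresh = merge-fresh {Γ = Γ} {Δ = Δ} {Λ = Λ} p q r
merge-Addʳ {x = x} {Λ = Λ} {A = A} p q r .at
  rewrite ⸴∶-at {Γ = Λ} {x} {A} r | p | q = refl
merge-Addʳ {x = x} {Λ = Λ} {A = A} p q r .off i i≢x
  rewrite ⸴∶-off {y = i} {x} {Λ} {A} i≢x = refl

merge-Split : Distinct (Γ ∷ Δ ∷ Δ′ ∷ Λ ∷ Λ′ ∷ []) →
  Split (merge Γ (Δ ⸴ Δ′) (Λ ⸴ Λ′)) (merge Γ Δ Λ) (merge Γ Δ′ Λ′)
merge-Split {Γ = Γ} {Δ} {Δ′} {Λ} {Λ′} d i
  rewrite lookup-zipWith _<∣>_ i Δ Δ′ | lookup-zipWith _<∣>_ i Λ Λ′ =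
  go (distinct⇒apart d i)
  where
  go : ∀ {γ δ δ′ λ₁ λ₂} → AtMostOne (γ ∷ δ ∷ δ′ ∷ λ₁ ∷ λ₂ ∷ []) →
    entry γ (δ <∣> δ′) (λ₁ <∣> λ₂) ≃ entry γ δ λ₁ ⋈ entry γ δ′ λ₂
  go (just _)                                                = unr
  go (nothing (just (refl ∷ refl ∷ refl ∷ [])))              = linˡ
  go (nothing (nothing (just (refl ∷ refl ∷ []))))           = linʳ
  go (nothing (nothing (nothing (just (refl ∷ [])))))        = linˡ
  go (nothing (nothing (nothing (nothing (just [])))))       = linʳ
  go (nothing (nothing (nothing (nothing (nothing [])))))    = none

∙-intro : {Θ : Cx (suc n)} → Θ ⊢ P → (Θ ∘ suc) ∙ Θ zero ⊢ P
∙-intro = weaken λ { zero → keep ; (suc i) → keep }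

-- Both `zero` and `suc x` are sent to `x` by the substitution. The inverse chooses `zero`, the
-- unrestricted name being substituted; `suc x` is then covered because `x` is fresh in the linear
-- context before insertion.
/zero-inv : Fin n → Fin n → Maybe (Fin (suc n))
/zero-inv x i with i ≟ x
... | yes _ = just zero
... | no _  = just (suc i)

/zero-inverse : Inverse (x /zero) (/zero-inv x)
/zero-inverse {x = x} .section {j = j} eq with j ≟ x
/zero-inverse .section refl | yes refl = refl
/zero-inverse .section refl | no _     = refl

open-⊢ : Open l A → Add Θ₀ x l Θ → Θ₀ ∙ unr A ⊢ P → Θ ⊢ P ⟨ x ⟩
open-⊢ {A = A} {Θ₀ = Θ₀} {x} {Θ} o a D = weaken s (rename-⊢ /zero-inverse cov D)
  where
  s : Θ ⇛ pull (/zero-inv x) (Θ₀ ∙ unr A)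
  s i with i ≟ x
  ... | yes refl = subst (_⇝ unr A) (sym (a .at)) (open′ o)
  ... | no i≢x   = ≡⇒⇝ (sym (a .off i i≢x))
  cov : Cover (x /zero) (/zero-inv x) (Θ₀ ∙ unr A)
  cov zero with x ≟ x
  ... | yes _   = inj₂ refl
  ... | no x≢x  = contradiction refl x≢x
  cov (suc i) with i ≟ x
  ... | yes refl = inj₁ (a .fresh)
  ... | no _     = inj₂ refl

-- The client P receives the end `l` of a linear cut and opens it at once; the server consumes the
-- other end `o` by `serve`. All linear names go to the client, the unrestricted ones to both sides.
server-cut : ∀ {t} → Open l A → Serve o t → Dual l o →
  merge Γ Δ Λ ∙ unr A ⊢ P → merge (Γ ↑) ∅ ∅ ∙ lin t ⊢ Q →
  merge Γ Δ Λ ⊢ ν (P ∣ serve zero Q)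
server-cut {l = l} {o = o} {Γ = Γ} {Δ} {Λ} p q r D E =
  recut (shared s r (weaken (∙-⇛ (λ _ → keep) (open′ p)) D)
    ((λ _ → keep) ▹ serve (insert refl refl λ { zero 0≢0 → contradiction refl 0≢0
                                              ; (suc i) _ → refl }) q
                          (merge-unr {Γ = Γ ↑}) E))
  where
  s : ∀ i → Share (merge Γ Δ Λ i) (merge Γ Δ Λ i) (merge Γ ∅ ∅ i)
  s i with lookup Γ i
  ... | just _  = both keep
  ... | nothing rewrite ∅-fresh {x = i} = inl keep

merge-Addˡ∅ : (Γ : Ctx n) → lookup Γ x ≡ nothing →
  Add (merge Γ ∅ ∅) x (left A) (merge Γ (x ∶ A) ∅)
merge-Addˡ∅ {x = x} {A} Γ p =
  subst (λ Δ → Add (merge Γ ∅ ∅) x (left A) (merge Γ Δ ∅)) (⸴-identityˡ (x ∶ A))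
    (merge-Addˡ {Γ = Γ} {Δ = ∅} {Λ = ∅} p (∅-fresh {x = x}) (∅-fresh {x = x}))

merge-Addʳ∅ : (Γ Δ : Ctx n) → lookup Γ x ≡ nothing → lookup Δ x ≡ nothing →
  Add (merge Γ Δ ∅) x (right A) (merge Γ Δ (x ∶ A))
merge-Addʳ∅ {x = x} {A} Γ Δ p q =
  subst (λ Λ → Add (merge Γ Δ ∅) x (right A) (merge Γ Δ Λ)) (⸴-identityˡ (x ∶ A))
    (merge-Addʳ {Γ = Γ} {Δ = Δ} {Λ = ∅} p q (∅-fresh {x = x}))

merge-addˡ : (Γ Δ Λ : Ctx n) → Distinct (Γ ∷ Δ ∷ x ∶ A ∷ Λ ∷ []) →
  Add (merge Γ Δ Λ) x (left B) (merge Γ (Δ ⸴ x ∶ B) Λ)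
merge-addˡ {x = x} Γ Δ Λ d with remove-∶ (Γ ∷ Δ ∷ []) {x = x} d
... | _ , p ∷ q ∷ r ∷ [] = merge-Addˡ {Γ = Γ} {Δ = Δ} {Λ = Λ} p q r

merge-addʳ : (Γ Δ Λ : Ctx n) → Distinct (Γ ∷ Δ ∷ Λ ∷ x ∶ A ∷ []) →
  Add (merge Γ Δ Λ) x (right B) (merge Γ Δ (Λ ⸴ x ∶ B))
merge-addʳ {x = x} Γ Δ Λ d with remove-∶ (Γ ∷ Δ ∷ Λ ∷ []) {x = x} d
... | _ , p ∷ q ∷ r ∷ [] = merge-Addʳ {Γ = Γ} {Δ = Δ} {Λ = Λ} p q r

merge-outˡ : (Γ Δ Δ′ Λ Λ′ : Ctx n) → Distinct (Γ ∷ Δ ∷ Δ′ ∷ x ∶ A ∷ Λ ∷ Λ′ ∷ []) →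
  Out (left A) d (left B) →
  merge Γ Δ Λ ∙ lin d ⊢ P → merge Γ (Δ′ ⸴ x ∶ B) Λ′ ∙ none ⊢ Q →
  merge Γ (Δ ⸴ Δ′ ⸴ x ∶ A) (Λ ⸴ Λ′) ⊢ ν (send (suc x) zero (P ∣ Q))
merge-outˡ {x = x} Γ Δ Δ′ Λ Λ′ d r D E with remove-∶ (Γ ∷ Δ ∷ Δ′ ∷ []) {x = x} d
... | d′ , γ ∷ δ ∷ δ′ ∷ p ∷ p′ ∷ [] = exactly (out
  (merge-Addˡ {Γ = Γ} {Δ = Δ ⸴ Δ′} {Λ = Λ ⸴ Λ′} γ
    (⸴-fresh {Γ = Δ} {Δ = Δ′} δ δ′) (⸴-fresh {Γ = Λ} {Δ = Λ′} p p′))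
  (merge-Split d′) (merge-Addˡ {Γ = Γ} {Δ = Δ′} {Λ = Λ′} γ δ′ p′) r D E)

merge-outʳ : (Γ Δ Δ′ Λ Λ′ : Ctx n) → Distinct (Γ ∷ Δ ∷ Δ′ ∷ Λ ∷ Λ′ ∷ x ∶ A ∷ []) →
  Out (right A) d (right B) →
  merge Γ Δ Λ ∙ lin d ⊢ P → merge Γ Δ′ (Λ′ ⸴ x ∶ B) ∙ none ⊢ Q →
  merge Γ (Δ ⸴ Δ′) (Λ ⸴ Λ′ ⸴ x ∶ A) ⊢ ν (send (suc x) zero (P ∣ Q))
merge-outʳ {x = x} Γ Δ Δ′ Λ Λ′ d r D E
  with remove-∶ (Γ ∷ Δ ∷ Δ′ ∷ Λ ∷ Λ′ ∷ []) {x = x} d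
... | d′ , γ ∷ δ ∷ δ′ ∷ p ∷ p′ ∷ [] = exactly (out
  (merge-Addʳ {Γ = Γ} {Δ = Δ ⸴ Δ′} {Λ = Λ ⸴ Λ′} γ
    (⸴-fresh {Γ = Δ} {Δ = Δ′} δ δ′) (⸴-fresh {Γ = Λ} {Δ = Λ′} p p′))
  (merge-Split d′) (merge-Addʳ {Γ = Γ} {Δ = Δ′} {Λ = Λ′} γ δ′ p′) r D E)

merge-copy : (Γ Δ Λ : Ctx n) → Distinct (Γ ∷ x ∶ A ∷ Δ ∷ Λ ∷ []) →
  merge (Γ ⸴ x ∶ A) Δ Λ x ≡ unr A
merge-copy {x = x} {A} Γ Δ Λ d with remove-∶ (Γ ∷ []) {x = x} d
... | _ , p ∷ _ rewrite ⸴∶-at {Γ = Γ} {x} {A} p = refl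

mutual
  complete : Γ ⨾ Δ ⊢ P ⦂ Λ → merge Γ Δ Λ ⊢ P
  complete (idR {Γ} {x} {y} {A} d) with remove-∶ (Γ ∷ x ∶ A ∷ []) {x = y} d
  ... | d′ , γy ∷ xy ∷ [] with remove-∶ (Γ ∷ []) {x = x} d′
  ... | _ , γx ∷ [] = exactly
    (fwd (merge-Addˡ∅ Γ γx) (merge-Addʳ∅ Γ (x ∶ A) γy xy) idR (merge-unr {Γ = Γ}))
  complete (idL {Γ} {x} {y} {A} d) with remove-∶ (Γ ∷ x ∶ A ∷ []) {x = y} d
  ... | d′ , γy ∷ xy ∷ [] with remove-∶ (Γ ∷ []) {x = x} d′
  ... | _ , γx ∷ [] = exactly
    (fwd (merge-Addˡ∅ Γ γx)
         (merge-Addˡ {Γ = Γ} {Δ = x ∶ A} {Λ = ∅} γy xy (∅-fresh {x = y}))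
         idL (merge-unr {Γ = Γ}))
  complete (𝟏R {Γ} {x} d) with remove-∶ (Γ ∷ []) {x = x} d
  ... | _ , p ∷ [] = exactly
    (close (merge-Addʳ∅ Γ ∅ p (∅-fresh {x = x})) 𝟏R (merge-unr {Γ = Γ}))
  complete (⊥L {Γ} {x} d) with remove-∶ (Γ ∷ []) {x = x} d
  ... | _ , p ∷ [] = exactly (close (merge-Addˡ∅ Γ p) ⊥L (merge-unr {Γ = Γ}))
  complete (𝟏L {Γ} {Δ} {Λ} d D) = exactly (wait (merge-addˡ Γ Δ Λ d) 𝟏L (complete D))
  complete (⊥R {Γ} {Δ} {Λ} d D) = exactly (wait (merge-addʳ Γ Δ Λ d) ⊥R (complete D))
  complete (⊗R {Γ} {Δ} {Δ′} {Λ} {Λ′} d D E) =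
    merge-outʳ Γ Δ Δ′ Λ Λ′ d ⊗R (∙-intro (complete D)) (∙-intro (complete E))
  complete (⅋L {Γ} {Δ} {Δ′} {Λ} {Λ′} d D E) =
    merge-outˡ Γ Δ Δ′ Λ Λ′ d ⅋L (∙-intro (complete D)) (∙-intro (complete E))
  complete (⊸L {Γ} {Δ} {Δ′} {Λ} {Λ′} d D E) =
    merge-outˡ Γ Δ Δ′ Λ Λ′ d ⊸L (∙-intro (complete D)) (∙-intro (complete E))
  complete (⊗L {Γ} {Δ} {Λ} d D) = exactly
    (recv (merge-addˡ Γ Δ Λ d) (merge-addˡ Γ Δ Λ d) ⊗L (∙-intro (complete D)))
  complete (⅋R {Γ} {Δ} {Λ} d D) = exactly
    (recv (merge-addʳ Γ Δ Λ d) (merge-addʳ Γ Δ Λ d) ⅋R (∙-intro (complete D)))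
  complete (⊸R {Γ} {Δ} {Λ} d D) = exactly
    (recv (merge-addʳ Γ Δ Λ d) (merge-addʳ Γ Δ Λ d) ⊸R (∙-intro (complete D)))
  complete (⊕R {Γ} {Δ} {Λ} d j D) = exactly
    (select (merge-addʳ Γ Δ Λ d) (merge-addʳ Γ Δ Λ d) (⊕R j) (complete D))
  complete (&L {Γ} {Δ} {Λ} d j D) = exactly
    (select (merge-addˡ Γ Δ Λ d) (merge-addˡ Γ Δ Λ d) (&L j) (complete D))
  complete (⊕L {Γ} {Δ} {Λ} d Ds) = exactly
    (branch (merge-addˡ Γ Δ Λ d) ⊕L (complete-⊕L (λ A → merge-addˡ Γ Δ Λ d) Ds))
  complete (&R {Γ} {Δ} {Λ} d Ds) = exactly
    (branch (merge-addʳ Γ Δ Λ d) &R (complete-&R (λ A → merge-addʳ Γ Δ Λ d) Ds))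
  complete (copyR {Γ} {Δ} {Λ} d D) = exactly
    (copy (merge-copy Γ Δ Λ d) copyR (∙-intro (complete D)))
  complete (copyL {Γ} {Δ} {Λ} d D) = exactly
    (copy (merge-copy Γ Δ Λ d) copyL (∙-intro (complete D)))
  complete (!R {Γ} {x = x} d D) with remove-∶ (Γ ∷ []) {x = x} d
  ... | _ , p ∷ [] = exactly
    (serve (merge-Addʳ∅ Γ ∅ p (∅-fresh {x = x})) !R (merge-unr {Γ = Γ}) (∙-intro (complete D)))
  complete (⁇L {Γ} {x = x} d D) with remove-∶ (Γ ∷ []) {x = x} d
  ... | _ , p ∷ [] = exactly
    (serve (merge-Addˡ∅ Γ p) ⁇L (merge-unr {Γ = Γ}) (∙-intro (complete D)))
  complete (!L {Γ} {Δ} {Λ} d D) = open-⊢ !L (merge-addˡ Γ Δ Λ d) (∙-intro (complete D))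
  complete (⁇R {Γ} {Δ} {Λ} d D) = open-⊢ ⁇R (merge-addʳ Γ Δ Λ d) (∙-intro (complete D))
  complete (cutRL d D E) = exactly
    (cut (merge-Split d) RL (∙-intro (complete D)) (∙-intro (complete E)))
  complete (cutLR d D E) = exactly
    (cut (merge-Split d) LR (∙-intro (complete D)) (∙-intro (complete E)))
  complete (cutRR d D E) = exactly
    (cut (merge-Split d) RR (∙-intro (complete D)) (∙-intro (complete E)))
  complete (cutLL d D E) = exactly
    (cut (merge-Split d) LL (∙-intro (complete D)) (∙-intro (complete E)))
  complete (cut!R {Γ} {Δ} {Λ} d D E) =
    server-cut {Γ = Γ} {Δ = Δ} {Λ = Λ} !L !R LR (∙-intro (complete D)) (∙-intro (complete E))
  complete (cut!L {Γ} {Δ} {Λ} d E D) = comm-⊢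
    (server-cut {Γ = Γ} {Δ = Δ} {Λ = Λ} !L !R LR (∙-intro (complete D)) (∙-intro (complete E)))
  complete (cut?R {Γ} {Δ} {Λ} d D E) =
    server-cut {Γ = Γ} {Δ = Δ} {Λ = Λ} ⁇R ⁇L RL (∙-intro (complete D)) (∙-intro (complete E))
  complete (cut?L {Γ} {Δ} {Λ} d E D) = comm-⊢
    (server-cut {Γ = Γ} {Δ = Δ} {Λ = Λ} ⁇R ⁇L RL (∙-intro (complete D)) (∙-intro (complete E)))

  complete-⊕L : ∀ {As Ps} → (∀ A → Add Θ₀ x (left A) (merge Γ (Δ ⸴ x ∶ A) Λ)) →
    Pointwise (λ A P → Γ ⨾ Δ ⸴ x ∶ A ⊢ P ⦂ Λ) As Ps →
    Pointwise (λ A P → ∃[ Θ ] Add Θ₀ x (left A) Θ × (Θ ⊢ P)) As Ps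
  complete-⊕L a (last D)    = last (_ , a _ , complete D)
  complete-⊕L a (cons D Ds) = cons (_ , a _ , complete D) (complete-⊕L a Ds)
  complete-⊕L a (skip Ds)   = skip (complete-⊕L a Ds)

  complete-&R : ∀ {As Ps} → (∀ A → Add Θ₀ x (right A) (merge Γ Δ (Λ ⸴ x ∶ A))) →
    Pointwise (λ A P → Γ ⨾ Δ ⊢ P ⦂ Λ ⸴ x ∶ A) As Ps →
    Pointwise (λ A P → ∃[ Θ ] Add Θ₀ x (right A) Θ × (Θ ⊢ P)) As Ps
  complete-&R a (last D)    = last (_ , a _ , complete D)
  complete-&R a (cons D Ds) = cons (_ , a _ , complete D) (complete-&R a Ds)
  complete-&R a (skip Ds)   = skip (complete-&R a Ds)

-- From the syntax-directed system to typing

unr-part left-part right-part : Entry → Maybe Type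
unr-part (unr A)         = just A
unr-part _               = nothing
left-part (lin (left A)) = just A
left-part _              = nothing
right-part (lin (right A)) = just A
right-part _               = nothing

⟦_⟧ᵘ ⟦_⟧ˡ ⟦_⟧ʳ : Cx n → Ctx n
⟦ Θ ⟧ᵘ = tabulate (unr-part ∘ Θ)
⟦ Θ ⟧ˡ = tabulate (left-part ∘ Θ)
⟦ Θ ⟧ʳ = tabulate (right-part ∘ Θ)

infix 3 _⊩_

_⊩_ : Cx n → Proc n → Set
Θ ⊩ P = ⟦ Θ ⟧ᵘ ⨾ ⟦ Θ ⟧ˡ ⊢ P ⦂ ⟦ Θ ⟧ʳ

conv : ∀ {Γ′} → Γ ≡ Γ′ → Δ ≡ Δ′ → Λ ≡ Λ′ → Γ ⨾ Δ ⊢ P ⦂ Λ → Γ′ ⨾ Δ′ ⊢ P ⦂ Λ′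
conv refl refl refl D = D

⊩-cong : Θ ≗ Θ′ → Θ ⊩ P → Θ′ ⊩ P
⊩-cong eq = conv (tabulate-cong (cong unr-part ∘ eq)) (tabulate-cong (cong left-part ∘ eq))
                 (tabulate-cong (cong right-part ∘ eq))

tabulate-Insert : (g : Entry → Maybe Type) → g none ≡ nothing → g e ≡ nothing →
  Insert Θ₀ x e Θ → tabulate (g ∘ Θ₀) ≡ tabulate (g ∘ Θ)
tabulate-Insert {Θ₀ = Θ₀} {x = x} {Θ = Θ} g p q a = tabulate-cong go
  where
  go : ∀ i → g (Θ₀ i) ≡ g (Θ i)
  go i with i ≟ x
  ... | yes refl rewrite a .fresh | a .at = trans p (sym q)
  ... | no i≢x   = cong g (a .off i i≢x)

tabulate-Insert-∶ : (g : Entry → Maybe Type) → g none ≡ nothing → g e ≡ just A →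
  Insert Θ₀ x e Θ → tabulate (g ∘ Θ₀) ⸴ x ∶ A ≡ tabulate (g ∘ Θ)
tabulate-Insert-∶ {A = A} {Θ₀ = Θ₀} {x = x} {Θ = Θ} g p q a = ctx-ext go
  where
  go : ∀ i → lookup (tabulate (g ∘ Θ₀) ⸴ x ∶ A) i ≡ lookup (tabulate (g ∘ Θ)) i
  go i with i ≟ x
  ... | yes refl rewrite lookup∘tabulate (g ∘ Θ) x | a .at | q =
    ⸴∶-at {Γ = tabulate (g ∘ Θ₀)}
      (trans (lookup∘tabulate (g ∘ Θ₀) x) (trans (cong g (a .fresh)) p))
  ... | no i≢x
    rewrite ⸴∶-off {y = i} {x} {tabulate (g ∘ Θ₀)} {A} i≢x
          | lookup∘tabulate (g ∘ Θ₀) i | lookup∘tabulate (g ∘ Θ) i | a .off i i≢x = refl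

⟦Add⟧ᵘ : Add Θ₀ x l Θ → ⟦ Θ₀ ⟧ᵘ ≡ ⟦ Θ ⟧ᵘ
⟦Add⟧ᵘ = tabulate-Insert unr-part refl refl

⟦Addʳ⟧ˡ : Add Θ₀ x (right A) Θ → ⟦ Θ₀ ⟧ˡ ≡ ⟦ Θ ⟧ˡ
⟦Addʳ⟧ˡ = tabulate-Insert left-part refl refl

⟦Addˡ⟧ʳ : Add Θ₀ x (left A) Θ → ⟦ Θ₀ ⟧ʳ ≡ ⟦ Θ ⟧ʳ
⟦Addˡ⟧ʳ = tabulate-Insert right-part refl refl

⟦Addˡ⟧ˡ : Add Θ₀ x (left A) Θ → ⟦ Θ₀ ⟧ˡ ⸴ x ∶ A ≡ ⟦ Θ ⟧ˡ
⟦Addˡ⟧ˡ = tabulate-Insert-∶ left-part refl refl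

⟦Addʳ⟧ʳ : Add Θ₀ x (right A) Θ → ⟦ Θ₀ ⟧ʳ ⸴ x ∶ A ≡ ⟦ Θ ⟧ʳ
⟦Addʳ⟧ʳ = tabulate-Insert-∶ right-part refl refl

⟦⟧-fresh : (Θ : Cx n) → Θ x ≡ none →
  lookup ⟦ Θ ⟧ᵘ x ≡ nothing × lookup ⟦ Θ ⟧ˡ x ≡ nothing × lookup ⟦ Θ ⟧ʳ x ≡ nothing
⟦⟧-fresh {x = x} Θ p
  rewrite lookup∘tabulate (unr-part ∘ Θ) x | lookup∘tabulate (left-part ∘ Θ) x
        | lookup∘tabulate (right-part ∘ Θ) x | p = refl , refl , refl

convˡ : Add Θ₀ x (left A) Θ → ⟦ Θ₀ ⟧ᵘ ⨾ ⟦ Θ₀ ⟧ˡ ⸴ x ∶ A ⊢ P ⦂ ⟦ Θ₀ ⟧ʳ → Θ ⊩ P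
convˡ a = conv (⟦Add⟧ᵘ a) (⟦Addˡ⟧ˡ a) (⟦Addˡ⟧ʳ a)

convʳ : Add Θ₀ x (right A) Θ → ⟦ Θ₀ ⟧ᵘ ⨾ ⟦ Θ₀ ⟧ˡ ⊢ P ⦂ ⟦ Θ₀ ⟧ʳ ⸴ x ∶ A → Θ ⊩ P
convʳ a = conv (⟦Add⟧ᵘ a) (⟦Addʳ⟧ˡ a) (⟦Addʳ⟧ʳ a)

convˡ⁻ : Add Θ₀ x (left A) Θ → Θ ⊩ P → ⟦ Θ₀ ⟧ᵘ ⨾ ⟦ Θ₀ ⟧ˡ ⸴ x ∶ A ⊢ P ⦂ ⟦ Θ₀ ⟧ʳ
convˡ⁻ a = conv (sym (⟦Add⟧ᵘ a)) (sym (⟦Addˡ⟧ˡ a)) (sym (⟦Addˡ⟧ʳ a))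

convʳ⁻ : Add Θ₀ x (right A) Θ → Θ ⊩ P → ⟦ Θ₀ ⟧ᵘ ⨾ ⟦ Θ₀ ⟧ˡ ⊢ P ⦂ ⟦ Θ₀ ⟧ʳ ⸴ x ∶ A
convʳ⁻ a = conv (sym (⟦Add⟧ᵘ a)) (sym (⟦Addʳ⟧ˡ a)) (sym (⟦Addʳ⟧ʳ a))

module _ (s : Split Θ Θ₁ Θ₂) where

  ⟦Split⟧ᵘ₁ : ⟦ Θ ⟧ᵘ ≡ ⟦ Θ₁ ⟧ᵘ
  ⟦Split⟧ᵘ₁ = tabulate-cong λ i → go (s i)
    where
    go : e ≃ e₁ ⋈ e₂ → unr-part e ≡ unr-part e₁
    go none = refl
    go unr  = refl
    go linˡ = refl
    go linʳ = refl

  ⟦Split⟧ᵘ₂ : ⟦ Θ ⟧ᵘ ≡ ⟦ Θ₂ ⟧ᵘ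
  ⟦Split⟧ᵘ₂ = tabulate-cong λ i → go (s i)
    where
    go : e ≃ e₁ ⋈ e₂ → unr-part e ≡ unr-part e₂
    go none = refl
    go unr  = refl
    go linˡ = refl
    go linʳ = refl

  tabulate-Split : (g : Entry → Maybe Type) → g none ≡ nothing → (∀ A → g (unr A) ≡ nothing) →
    tabulate (g ∘ Θ₁) ⸴ tabulate (g ∘ Θ₂) ≡ tabulate (g ∘ Θ)
  tabulate-Split g p q = ctx-ext λ i →
    trans (lookup-zipWith _<∣>_ i (tabulate (g ∘ Θ₁)) (tabulate (g ∘ Θ₂)))
    (trans (cong₂ _<∣>_ (lookup∘tabulate (g ∘ Θ₁) i) (lookup∘tabulate (g ∘ Θ₂) i))
    (trans (go (s i)) (sym (lookup∘tabulate (g ∘ Θ) i))))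
    where
    go : e ≃ e₁ ⋈ e₂ → (g e₁ <∣> g e₂) ≡ g e
    go none rewrite p = refl
    go (unr {A}) rewrite q A = refl
    go linˡ rewrite p = <∣>-nothing _
    go linʳ rewrite p = refl

  ⟦Split⟧ˡ : ⟦ Θ₁ ⟧ˡ ⸴ ⟦ Θ₂ ⟧ˡ ≡ ⟦ Θ ⟧ˡ
  ⟦Split⟧ˡ = tabulate-Split left-part refl λ _ → refl

  ⟦Split⟧ʳ : ⟦ Θ₁ ⟧ʳ ⸴ ⟦ Θ₂ ⟧ʳ ≡ ⟦ Θ ⟧ʳ
  ⟦Split⟧ʳ = tabulate-Split right-part refl λ _ → refl

  ⟦Split⟧-distinct : Distinct (⟦ Θ ⟧ᵘ ∷ ⟦ Θ₁ ⟧ˡ ∷ ⟦ Θ₂ ⟧ˡ ∷ ⟦ Θ₁ ⟧ʳ ∷ ⟦ Θ₂ ⟧ʳ ∷ [])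
  ⟦Split⟧-distinct = apart⇒distinct _ apart
    where
    go : e ≃ e₁ ⋈ e₂ → AtMostOne
      (unr-part e ∷ left-part e₁ ∷ left-part e₂ ∷ right-part e₁ ∷ right-part e₂ ∷ [])
    go none = nothing (nothing (nothing (nothing (nothing []))))
    go unr  = just (refl ∷ refl ∷ refl ∷ refl ∷ [])
    go (linˡ {left _})  = nothing (just (refl ∷ refl ∷ refl ∷ []))
    go (linˡ {right _}) = nothing (nothing (nothing (just (refl ∷ []))))
    go (linʳ {left _})  = nothing (nothing (just (refl ∷ refl ∷ [])))
    go (linʳ {right _}) = nothing (nothing (nothing (nothing (just []))))
    apart : Apart (⟦ Θ ⟧ᵘ ∷ ⟦ Θ₁ ⟧ˡ ∷ ⟦ Θ₂ ⟧ˡ ∷ ⟦ Θ₁ ⟧ʳ ∷ ⟦ Θ₂ ⟧ʳ ∷ [])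
    apart i
      rewrite lookup∘tabulate (unr-part ∘ Θ) i
            | lookup∘tabulate (left-part ∘ Θ₁) i | lookup∘tabulate (left-part ∘ Θ₂) i
            | lookup∘tabulate (right-part ∘ Θ₁) i | lookup∘tabulate (right-part ∘ Θ₂) i = go (s i)

⟦⟧-distinct : (Θ : Cx n) → Distinct (⟦ Θ ⟧ᵘ ∷ ⟦ Θ ⟧ˡ ∷ ⟦ Θ ⟧ʳ ∷ [])
⟦⟧-distinct Θ = apart⇒distinct _ apart
  where
  go : ∀ e → AtMostOne (unr-part e ∷ left-part e ∷ right-part e ∷ [])
  go none            = nothing (nothing (nothing []))
  go (unr _)         = just (refl ∷ refl ∷ [])
  go (lin (left _))  = nothing (just (refl ∷ []))
  go (lin (right _)) = nothing (nothing (just []))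
  apart : Apart (⟦ Θ ⟧ᵘ ∷ ⟦ Θ ⟧ˡ ∷ ⟦ Θ ⟧ʳ ∷ [])
  apart i
    rewrite lookup∘tabulate (unr-part ∘ Θ) i | lookup∘tabulate (left-part ∘ Θ) i
          | lookup∘tabulate (right-part ∘ Θ) i = go (Θ i)

distinctˡ : Add Θ₀ x l Θ → Distinct (⟦ Θ₀ ⟧ᵘ ∷ ⟦ Θ₀ ⟧ˡ ∷ x ∶ A ∷ ⟦ Θ₀ ⟧ʳ ∷ [])
distinctˡ {Θ₀ = Θ₀} a with ⟦⟧-fresh Θ₀ (a .fresh)
... | p , q , r = insert-∶ (⟦ Θ₀ ⟧ᵘ ∷ ⟦ Θ₀ ⟧ˡ ∷ []) (⟦⟧-distinct Θ₀) (p ∷ q ∷ r ∷ [])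

distinctʳ : Add Θ₀ x l Θ → Distinct (⟦ Θ₀ ⟧ᵘ ∷ ⟦ Θ₀ ⟧ˡ ∷ ⟦ Θ₀ ⟧ʳ ∷ x ∶ A ∷ [])
distinctʳ {Θ₀ = Θ₀} a with ⟦⟧-fresh Θ₀ (a .fresh)
... | p , q , r = insert-∶ (⟦ Θ₀ ⟧ᵘ ∷ ⟦ Θ₀ ⟧ˡ ∷ ⟦ Θ₀ ⟧ʳ ∷ []) (⟦⟧-distinct Θ₀) (p ∷ q ∷ r ∷ [])

split-distinctˡ : Split Θ₀ Θ₁ Θ₂ → Θ₀ x ≡ none →
  Distinct (⟦ Θ₀ ⟧ᵘ ∷ ⟦ Θ₁ ⟧ˡ ∷ ⟦ Θ₂ ⟧ˡ ∷ x ∶ A ∷ ⟦ Θ₁ ⟧ʳ ∷ ⟦ Θ₂ ⟧ʳ ∷ [])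
split-distinctˡ {Θ₀ = Θ₀} {Θ₁} {Θ₂} {x} s p with ≃-none (s x) p
... | p₁ , p₂ with ⟦⟧-fresh Θ₀ p | ⟦⟧-fresh Θ₁ p₁ | ⟦⟧-fresh Θ₂ p₂
... | u , _ | _ , q₁ , r₁ | _ , q₂ , r₂ =
  insert-∶ (⟦ Θ₀ ⟧ᵘ ∷ ⟦ Θ₁ ⟧ˡ ∷ ⟦ Θ₂ ⟧ˡ ∷ []) (⟦Split⟧-distinct s)
    (u ∷ q₁ ∷ q₂ ∷ r₁ ∷ r₂ ∷ [])

split-distinctʳ : Split Θ₀ Θ₁ Θ₂ → Θ₀ x ≡ none →
  Distinct (⟦ Θ₀ ⟧ᵘ ∷ ⟦ Θ₁ ⟧ˡ ∷ ⟦ Θ₂ ⟧ˡ ∷ ⟦ Θ₁ ⟧ʳ ∷ ⟦ Θ₂ ⟧ʳ ∷ x ∶ A ∷ [])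
split-distinctʳ {Θ₀ = Θ₀} {Θ₁} {Θ₂} {x} s p with ≃-none (s x) p
... | p₁ , p₂ with ⟦⟧-fresh Θ₀ p | ⟦⟧-fresh Θ₁ p₁ | ⟦⟧-fresh Θ₂ p₂
... | u , _ | _ , q₁ , r₁ | _ , q₂ , r₂ =
  insert-∶ (⟦ Θ₀ ⟧ᵘ ∷ ⟦ Θ₁ ⟧ˡ ∷ ⟦ Θ₂ ⟧ˡ ∷ ⟦ Θ₁ ⟧ʳ ∷ ⟦ Θ₂ ⟧ʳ ∷ []) (⟦Split⟧-distinct s)
    (u ∷ q₁ ∷ q₂ ∷ r₁ ∷ r₂ ∷ [])

conv-∙ : ∀ {Γ′ r s t} → Γ ≡ Γ′ → Δ ≡ Δ′ → Λ ≡ Λ′ →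
  r ∷ Γ ⨾ s ∷ Δ ⊢ P ⦂ t ∷ Λ → r ∷ Γ′ ⨾ s ∷ Δ′ ⊢ P ⦂ t ∷ Λ′
conv-∙ refl refl refl D = D

⟦Unr⟧ˡ : AllUnr Θ → ⟦ Θ ⟧ˡ ≡ ∅
⟦Unr⟧ˡ {Θ = Θ} u = ctx-ext λ i →
  trans (lookup∘tabulate (left-part ∘ Θ) i) (trans (go (u i)) (sym (∅-fresh {x = i})))
  where
  go : Unr e → left-part e ≡ nothing
  go none = refl
  go unr  = refl

⟦Unr⟧ʳ : AllUnr Θ → ⟦ Θ ⟧ʳ ≡ ∅
⟦Unr⟧ʳ {Θ = Θ} u = ctx-ext λ i →
  trans (lookup∘tabulate (right-part ∘ Θ) i) (trans (go (u i)) (sym (∅-fresh {x = i})))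
  where
  go : Unr e → right-part e ≡ nothing
  go none = refl
  go unr  = refl

⟦Addˡ-Unr⟧ˡ : Add Θ₀ x (left A) Θ → AllUnr Θ₀ → x ∶ A ≡ ⟦ Θ ⟧ˡ
⟦Addˡ-Unr⟧ˡ {x = x} {A = A} a u =
  trans (sym (trans (cong (_⸴ x ∶ A) (⟦Unr⟧ˡ u)) (⸴-identityˡ _))) (⟦Addˡ⟧ˡ a)

⟦Addʳ-Unr⟧ʳ : Add Θ₀ x (right A) Θ → ⟦ Θ₀ ⟧ʳ ≡ ∅ → x ∶ A ≡ ⟦ Θ ⟧ʳ
⟦Addʳ-Unr⟧ʳ {x = x} {A = A} a u =
  trans (sym (trans (cong (_⸴ x ∶ A) u) (⸴-identityˡ _))) (⟦Addʳ⟧ʳ a)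

singleton-distinct : Add Θ₀ x l Θ → Distinct (⟦ Θ₀ ⟧ᵘ ∷ x ∶ A ∷ [])
singleton-distinct {Θ₀ = Θ₀} a =
  insert-∶ (⟦ Θ₀ ⟧ᵘ ∷ []) ([] ∷ []) (⟦⟧-fresh Θ₀ (a .fresh) .proj₁ ∷ [])

pair-distinct : Add Θ₀ x l Θ₁ → Add Θ₁ y o Θ →
  Distinct (⟦ Θ₀ ⟧ᵘ ∷ x ∶ A ∷ y ∶ B ∷ [])
pair-distinct {Θ₀ = Θ₀} {x} {Θ₁ = Θ₁} {y} {A = A} a b =
  insert-∶ (⟦ Θ₀ ⟧ᵘ ∷ x ∶ A ∷ []) (singleton-distinct a)
    (⟦⟧-fresh Θ₀ (trans (a .off y y≢x) (b .fresh)) .proj₁ ∷ ∶-off y≢x ∷ [])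
  where
  y≢x : y ≢ x
  y≢x refl with () ← trans (sym (a .at)) (b .fresh)

insertion : Θ x ≡ e → Insert (updateAt Θ x (λ _ → none)) x e Θ
insertion {Θ = Θ} {x} p = insert (updateAt-updates x Θ) p λ i → updateAt-minimal i x Θ

-- Weakening without opening, for exact derivations

-- Typing has no weakening rule, so unrestricted names dropped before a rule must be put back before
-- that rule is translated. `U` will be the unrestricted part of the context before dropping.
fill : (Fin n → Maybe Type) → Cx n → Cx n
fill U Θ i = maybe unr (Θ i) (U i)

-- As `unr A` leads only to itself and to `none`, this forces `Θ` to hold one of these two wherever
-- `U` is `just A`; linear entries are never overwritten.
Fillable : (Fin n → Maybe Type) → Cx n → Set
Fillable U Θ = fill U Θ ⇛ Θ

module _ {U : Fin n → Maybe Type} where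

  fill-Add : U x ≡ nothing → Add Θ₀ x l Θ → Add (fill U Θ₀) x l (fill U Θ)
  fill-Add p a .fresh rewrite p = a .fresh
  fill-Add p a .at rewrite p = a .at
  fill-Add p a .off i i≢x = cong (λ e → maybe unr e (U i)) (a .off i i≢x)

  fill-Split : Split Θ Θ₁ Θ₂ → Split (fill U Θ) (fill U Θ₁) (fill U Θ₂)
  fill-Split s i with U i
  ... | just _  = unr
  ... | nothing = s i

  fill-Unr : AllUnr Θ → AllUnr (fill U Θ)
  fill-Unr u i with U i
  ... | just _  = unr
  ... | nothing = u i

  fillable-at : Θ x ≡ lin l → Fillable U Θ → U x ≡ nothing
  fillable-at {x = x} p c with U x | c x
  ... | nothing | _ = refl
  ... | just A  | s with () ← subst (unr A ⇝_) p s

  fillable-Add : Add Θ₀ x l Θ → Fillable U Θ → U x ≡ nothing × Fillable U Θ₀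
  fillable-Add {Θ₀ = Θ₀} {x} {Θ = Θ} a c = p , c₀
    where
    p : U x ≡ nothing
    p = fillable-at (a .at) c
    c₀ : Fillable U Θ₀
    c₀ i with i ≟ x
    ... | yes refl rewrite p = keep
    ... | no i≢x rewrite a .off i i≢x = c i

  fillable-Add′ : U x ≡ nothing → Add Θ₀ x l Θ → Fillable U Θ₀ → Fillable U Θ
  fillable-Add′ {x = x} p a c i with i ≟ x
  ... | yes refl rewrite p = keep
  ... | no i≢x rewrite sym (a .off i i≢x) = c i

  fillable-Split : Split Θ Θ₁ Θ₂ → Fillable U Θ → Fillable U Θ₁ × Fillable U Θ₂
  fillable-Split {Θ = Θ} {Θ₁} {Θ₂} s c = (λ i → go (s i) (U i) (c i) .proj₁) ,
                                         (λ i → go (s i) (U i) (c i) .proj₂)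
    where
    go : e ≃ e₁ ⋈ e₂ → (m : Maybe Type) → maybe unr e m ⇝ e →
         (maybe unr e₁ m ⇝ e₁) × (maybe unr e₂ m ⇝ e₂)
    go s    nothing  t    = keep , keep
    go none (just _) t    = t , t
    go unr  (just _) t    = t , t
    go linˡ (just _) ()
    go linʳ (just _) ()

  fill-∙-⊢ : Fillable U Θ → Θ ∙ e ⊢ P → fill U Θ ∙ e ⊢ P
  fill-∙-⊢ c = weaken (∙-⇛ c keep)

  fill-branches : ∀ {t : Type → Lin} {As Ps} → U x ≡ nothing → Fillable U Θ₀ →
    Pointwise (λ A P → ∃[ Θ ] Add Θ₀ x (t A) Θ × (Θ ⊢ P)) As Ps →
    Pointwise (λ A P → ∃[ Θ ] Add (fill U Θ₀) x (t A) Θ × (Θ ⊢ P)) As Ps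
  fill-branches p c (last (_ , a , D)) =
    last (_ , fill-Add p a , weaken (fillable-Add′ p a c) D)
  fill-branches p c (cons (_ , a , D) Ds) =
    cons (_ , fill-Add p a , weaken (fillable-Add′ p a c) D) (fill-branches p c Ds)
  fill-branches p c (skip Ds) = skip (fill-branches p c Ds)

  -- Only the last rule has to change, without recursion into the derivation: its premises are `_⊢_`
  -- judgments and drop the added names in their own initial weakening.
  fill-⊢° : Fillable U Θ → Θ ⊢° P → fill U Θ ⊢° P
  fill-⊢° c (fwd a b r u) =
    let py , c₁ = fillable-Add b c ; px , c₀ = fillable-Add a c₁
    in fwd (fill-Add px a) (fill-Add py b) r (fill-Unr u)
  fill-⊢° c (close a r u) =
    let p , c₀ = fillable-Add a c in close (fill-Add p a) r (fill-Unr u)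
  fill-⊢° c (wait a r D) =
    let p , c₀ = fillable-Add a c in wait (fill-Add p a) r (weaken c₀ D)
  fill-⊢° c (out a s b r D E) =
    let p , c₀ = fillable-Add a c ; c₁ , c₂ = fillable-Split s c₀
    in out (fill-Add p a) (fill-Split s) (fill-Add p b) r
           (fill-∙-⊢ c₁ D) (fill-∙-⊢ (fillable-Add′ p b c₂) E)
  fill-⊢° c (recv a b r D) =
    let p , c₀ = fillable-Add a c
    in recv (fill-Add p a) (fill-Add p b) r (fill-∙-⊢ (fillable-Add′ p b c₀) D)
  fill-⊢° c (select a b r D) =
    let p , c₀ = fillable-Add a c
    in select (fill-Add p a) (fill-Add p b) r (weaken (fillable-Add′ p b c₀) D)
  fill-⊢° c (branch a r Ds) =
    let p , c₀ = fillable-Add a c in branch (fill-Add p a) r (fill-branches p c₀ Ds)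
  fill-⊢° {Θ = Θ} c (copy {x = x} {A = A} e r D) = copy (at-x (U x) (c x)) r (fill-∙-⊢ c D)
    where
    at-x : ∀ m → maybe unr (Θ x) m ⇝ Θ x → maybe unr (Θ x) m ≡ unr A
    at-x nothing  s = e
    at-x (just B) s with keep ← subst (unr B ⇝_) e s = refl
  fill-⊢° c (serve a r u D) =
    let p , c₀ = fillable-Add a c in serve (fill-Add p a) r (fill-Unr u) (fill-∙-⊢ c₀ D)
  fill-⊢° c (cut s r D E) =
    let c₁ , c₂ = fillable-Split s c
    in cut (fill-Split s) r (fill-∙-⊢ c₁ D) (fill-∙-⊢ c₂ E)

-- Opening one name at a time

Opened : Entry → Entry → Set
Opened e f = ∃[ l ] ∃[ A ] e ≡ lin l × Open l A × unr A ⇝ f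

-- An opening has to become an instance of `!L` or `⁇R`; every other step is undone by `fill`. The
-- right-hand alternative is exactly what filling computes, so if it holds at all names, the whole
-- context is restored.
opened? : e ⇝ f → Opened e f ⊎ maybe unr f (unr-part e) ≡ e
opened? {none}  keep    = inj₂ refl
opened? {unr _} keep    = inj₂ refl
opened? {lin _} keep    = inj₂ refl
opened? drop            = inj₂ refl
opened? (open′ o)       = inj₁ (_ , _ , refl , o , keep)
opened? (discard o)     = inj₁ (_ , _ , refl , o , drop)

∃⊎∀ : {P Q : Fin n → Set} → (∀ i → P i ⊎ Q i) → ∃ P ⊎ (∀ i → Q i)
∃⊎∀ {zero}  f = inj₂ λ ()
∃⊎∀ {suc n} f with f zero | ∃⊎∀ (f ∘ suc)
... | inj₁ p | _            = inj₁ (zero , p)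
... | inj₂ q | inj₁ (i , p) = inj₁ (suc i , p)
... | inj₂ q | inj₂ qs      = inj₂ λ { zero → q ; (suc i) → qs i }

weight : Entry → ℕ
weight (lin _) = 1
weight _       = 0

-- Opening a name does not shrink the process, but it does lower this number.
#lin : Cx n → ℕ
#lin {zero}  Θ = 0
#lin {suc n} Θ = weight (Θ zero) + #lin (Θ ∘ suc)

#lin-cong : Θ ≗ Θ′ → #lin Θ ≡ #lin Θ′
#lin-cong {zero}  eq = refl
#lin-cong {suc n} eq = cong₂ _+_ (cong weight (eq zero)) (#lin-cong (eq ∘ suc))

#lin-Add : Add Θ₀ x l Θ → #lin Θ ≡ suc (#lin Θ₀)
#lin-Add {x = zero} a rewrite a .at | a .fresh =
  cong suc (sym (#lin-cong λ i → a .off (suc i) λ ()))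
#lin-Add {x = suc x} {Θ = Θ} a rewrite a .off zero (λ ()) =
  trans (cong (weight (Θ zero) +_) (#lin-Add {x = x}
          (insert (a .fresh) (a .at) (λ i i≢x → a .off (suc i) (i≢x ∘ suc-injective)))))
        (+-suc (weight (Θ zero)) _)

-- A section of `x /zero`: it moves all occurrences of `x` to the new name `zero`. Every process
-- thereby takes the form `P ⟨ x ⟩` that the conclusions of `!L` and `⁇R` require.
promote : Fin n → Fin n → Fin (suc n)
promote x i with i ≟ x
... | yes _ = zero
... | no _  = suc i

promote-inv : Fin n → Fin (suc n) → Maybe (Fin n)
promote-inv x zero = just x
promote-inv x (suc i) with i ≟ x
... | yes _ = nothing
... | no _  = just i

promote-inverse : Inverse (promote x) (promote-inv x)
promote-inverse {x = x} .section {j = zero} refl with x ≟ x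
... | yes _  = refl
... | no x≢x = contradiction refl x≢x
promote-inverse {x = x} .section {j = suc j} eq with j ≟ x in eq′
promote-inverse {x = x} .section {j = suc j} refl | no _ rewrite eq′ = refl

promote-cover : (x i : Fin n) → promote-inv x (promote x i) ≡ just i
promote-cover x i with i ≟ x in eq
... | yes refl = refl
... | no _ rewrite eq = refl

/zero-promote : (x i : Fin n) → (x /zero) (promote x i) ≡ i
/zero-promote x i with i ≟ x
... | yes refl = refl
... | no _     = refl

promote-⊢ : Insert Θ₀ x (unr A) Θ → Θ ⊢ P → Θ₀ ∙ unr A ⊢ rename (promote x) P
promote-⊢ {Θ₀ = Θ₀} {x} {A} {Θ} a D =
  weaken s (rename-⊢ promote-inverse (λ i → inj₂ (promote-cover x i)) D)
  where
  s : Θ₀ ∙ unr A ⇛ pull (promote-inv x) Θ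
  s zero = ≡⇒⇝ (sym (a .at))
  s (suc i) with i ≟ x
  ... | yes refl = ≡⇒⇝ (a .fresh)
  ... | no i≢x   = ≡⇒⇝ (a .off i i≢x)

sound-open : Open l A → Add Θ₀ x l Θ → Θ₀ ∙ unr A ⊩ rename (promote x) P → Θ ⊩ P
sound-open {x = x} {P = P} o a D = subst (_ ⊩_) eq (go o a D)
  where
  eq : rename (promote x) P ⟨ x ⟩ ≡ P
  eq = trans (rename-∘ P) (rename-id (/zero-promote x) P)
  go : Open l A → Add Θ₀ x l Θ → Θ₀ ∙ unr A ⊩ Q → Θ ⊩ Q ⟨ x ⟩
  go !L a D = convˡ a (!L (distinctˡ a) D)
  go ⁇R a D = convʳ a (⁇R (distinctʳ a) D)

-- A name that is opened becomes, in the premise of !L or ⁇R, the name zero.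
-- Quantifying over ρ makes the subterms of rename (promote x) (rename ρ P)
-- accessible to the recursion on P.

reinsert : Insert Θ₀ x f Θ → Insert Θ₀ x e (updateAt Θ₀ x (λ _ → e))
reinsert {Θ₀ = Θ₀} {x} a = insert (a .fresh) (updateAt-updates x Θ₀)
  λ i i≢x → sym (updateAt-minimal i x Θ₀ i≢x)

⟦copy⟧ : Insert Θ₀ x (unr A) Θ →
  ⟦ Θ₀ ⟧ᵘ ⸴ x ∶ A ≡ ⟦ Θ ⟧ᵘ × ⟦ Θ₀ ⟧ˡ ≡ ⟦ Θ ⟧ˡ × ⟦ Θ₀ ⟧ʳ ≡ ⟦ Θ ⟧ʳ
⟦copy⟧ a = tabulate-Insert-∶ unr-part refl refl a ,
           tabulate-Insert left-part refl refl a , tabulate-Insert right-part refl refl a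

copy-distinct : Insert Θ₀ x e Θ → Distinct (⟦ Θ₀ ⟧ᵘ ∷ x ∶ A ∷ ⟦ Θ₀ ⟧ˡ ∷ ⟦ Θ₀ ⟧ʳ ∷ [])
copy-distinct {Θ₀ = Θ₀} a with ⟦⟧-fresh Θ₀ (a .fresh)
... | p , q , r = insert-∶ (⟦ Θ₀ ⟧ᵘ ∷ []) (⟦⟧-distinct Θ₀) (p ∷ q ∷ r ∷ [])

opened-⇛ : Insert Θ₀ x (unr A) Θ₁ → Add Θ₀ x l Θ → unr A ⇝ Θ₂ x → Θ ⇛ Θ₂ → Θ₁ ⇛ Θ₂
opened-⇛ {x = x} {Θ₂ = Θ₂} a b t s i with i ≟ x
... | yes refl = subst (_⇝ Θ₂ x) (sym (a .at)) t
... | no i≢x   = subst (_⇝ Θ₂ i) (trans (sym (b .off i i≢x)) (a .off i i≢x)) (s i)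

mutual
  sound : (P : Proc m) (ρ : Fin m → Fin n) → Θ ⊢ rename ρ P → Θ ⊩ rename ρ P
  sound P ρ D = sound-# P _ ρ refl D

  -- Lexicographic induction on `P` and `k`. If the initial step opens some name, `!L` or `⁇R` is
  -- applied to it and `k` decreases while `P` stays. Otherwise the dropped names are filled in and
  -- the last rule is translated, which leads to proper subterms of `P`.
  sound-# : (P : Proc m) (k : ℕ) (ρ : Fin m → Fin n) → #lin Θ ≡ k →
    Θ ⊢ rename ρ P → Θ ⊩ rename ρ P
  sound-# {Θ = Θ} P k ρ # (s ▹ D) with ∃⊎∀ (λ i → opened? (s i))
  ... | inj₂ eq = ⊩-cong eq
    (sound° P ρ (fill-⊢° {U = unr-part ∘ Θ} (λ i → subst (_⇝ _) (sym (eq i)) (s i)) D))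
  ... | inj₁ (x , l , A , p , o , t) =
    let a = insertion p
        b = reinsert a
    in sound-opened P k ρ # o a (opened-⇛ b a t s ▹ D) b

  sound-opened : (P : Proc m) (k : ℕ) (ρ : Fin m → Fin n) → #lin Θ ≡ k →
    Open l A → Add Θ₀ x l Θ → Θ₁ ⊢ rename ρ P → Insert Θ₀ x (unr A) Θ₁ → Θ ⊩ rename ρ P
  sound-opened P zero ρ # o a D b with () ← trans (sym #) (#lin-Add a)
  sound-opened {A = A} {Θ₀ = Θ₀} P (suc k) ρ # o a D b = sound-open o a (subst (Θ₀ ∙ unr A ⊩_) (sym (rename-∘ P))
    (sound-# P k _ (ℕ-suc-injective (trans (sym (#lin-Add a)) #))
      (subst (_ ⊢_) (rename-∘ P) (promote-⊢ b D))))

  sound° : (P : Proc m) (ρ : Fin m → Fin n) → Θ ⊢° rename ρ P → Θ ⊩ rename ρ P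
  sound° (ν (P ∣ Q)) ρ (cut s RL D E) = conv refl (⟦Split⟧ˡ s) (⟦Split⟧ʳ s)
    (cutRL (⟦Split⟧-distinct s)
      (conv-∙ (sym (⟦Split⟧ᵘ₁ s)) refl refl (sound P _ D))
      (conv-∙ (sym (⟦Split⟧ᵘ₂ s)) refl refl (sound Q _ E)))
  sound° (ν (P ∣ Q)) ρ (cut s LR D E) = conv refl (⟦Split⟧ˡ s) (⟦Split⟧ʳ s)
    (cutLR (⟦Split⟧-distinct s)
      (conv-∙ (sym (⟦Split⟧ᵘ₁ s)) refl refl (sound P _ D))
      (conv-∙ (sym (⟦Split⟧ᵘ₂ s)) refl refl (sound Q _ E)))
  sound° (ν (P ∣ Q)) ρ (cut s RR D E) = conv refl (⟦Split⟧ˡ s) (⟦Split⟧ʳ s)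
    (cutRR (⟦Split⟧-distinct s)
      (conv-∙ (sym (⟦Split⟧ᵘ₁ s)) refl refl (sound P _ D))
      (conv-∙ (sym (⟦Split⟧ᵘ₂ s)) refl refl (sound Q _ E)))
  sound° (ν (P ∣ Q)) ρ (cut s LL D E) = conv refl (⟦Split⟧ˡ s) (⟦Split⟧ʳ s)
    (cutLL (⟦Split⟧-distinct s)
      (conv-∙ (sym (⟦Split⟧ᵘ₁ s)) refl refl (sound P _ D))
      (conv-∙ (sym (⟦Split⟧ᵘ₂ s)) refl refl (sound Q _ E)))
  sound° (ν (send (suc x) zero (P ∣ Q))) ρ (out a s b ⊗R D E) = convʳ a
    (conv refl (⟦Split⟧ˡ s) (cong (_⸴ _ ∶ _) (⟦Split⟧ʳ s))
      (⊗R (split-distinctʳ s (a .fresh))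
        (conv-∙ (sym (⟦Split⟧ᵘ₁ s)) refl refl (sound P _ D))
        (conv-∙ (sym (trans (⟦Split⟧ᵘ₂ s) (⟦Add⟧ᵘ b))) (sym (⟦Addʳ⟧ˡ b)) (sym (⟦Addʳ⟧ʳ b))
          (sound Q _ E))))
  sound° (ν (send (suc x) zero (P ∣ Q))) ρ (out a s b ⅋L D E) = convˡ a
    (conv refl (cong (_⸴ _ ∶ _) (⟦Split⟧ˡ s)) (⟦Split⟧ʳ s)
      (⅋L (split-distinctˡ s (a .fresh))
        (conv-∙ (sym (⟦Split⟧ᵘ₁ s)) refl refl (sound P _ D))
        (conv-∙ (sym (trans (⟦Split⟧ᵘ₂ s) (⟦Add⟧ᵘ b))) (sym (⟦Addˡ⟧ˡ b)) (sym (⟦Addˡ⟧ʳ b))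
          (sound Q _ E))))
  sound° (ν (send (suc x) zero (P ∣ Q))) ρ (out a s b ⊸L D E) = convˡ a
    (conv refl (cong (_⸴ _ ∶ _) (⟦Split⟧ˡ s)) (⟦Split⟧ʳ s)
      (⊸L (split-distinctˡ s (a .fresh))
        (conv-∙ (sym (⟦Split⟧ᵘ₁ s)) refl refl (sound P _ D))
        (conv-∙ (sym (trans (⟦Split⟧ᵘ₂ s) (⟦Add⟧ᵘ b))) (sym (⟦Addˡ⟧ˡ b)) (sym (⟦Addˡ⟧ʳ b))
          (sound Q _ E))))
  sound° (ν (send (suc x) zero P)) ρ (copy e copyR D) =
    let a = insertion e ; u , l , r = ⟦copy⟧ a
    in conv u l r (copyR (copy-distinct a)
         (conv-∙ (sym u) (sym l) (sym r) (sound P _ D)))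
  sound° (ν (send (suc x) zero P)) ρ (copy e copyL D) =
    let a = insertion e ; u , l , r = ⟦copy⟧ a
    in conv u l r (copyL (copy-distinct a)
         (conv-∙ (sym u) (sym l) (sym r) (sound P _ D)))
  sound° (ν (send zero y P)) ρ ()
  sound° (ν (send (suc x) (suc y) P)) ρ ()
  sound° (recv x P) ρ (recv a b ⊗L D) = convˡ a (⊗L (distinctˡ a)
    (conv-∙ (sym (⟦Add⟧ᵘ b)) (sym (⟦Addˡ⟧ˡ b)) (sym (⟦Addˡ⟧ʳ b)) (sound P _ D)))
  sound° (recv x P) ρ (recv a b ⅋R D) = convʳ a (⅋R (distinctʳ a)
    (conv-∙ (sym (⟦Add⟧ᵘ b)) (sym (⟦Addʳ⟧ˡ b)) (sym (⟦Addʳ⟧ʳ b)) (sound P _ D)))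
  sound° (recv x P) ρ (recv a b ⊸R D) = convʳ a (⊸R (distinctʳ a)
    (conv-∙ (sym (⟦Add⟧ᵘ b)) (sym (⟦Addʳ⟧ˡ b)) (sym (⟦Addʳ⟧ʳ b)) (sound P _ D)))
  sound° (select x j P) ρ (select a b (⊕R p) D) =
    convʳ a (⊕R (distinctʳ a) p (convʳ⁻ b (sound P _ D)))
  sound° (select x j P) ρ (select a b (&L p) D) =
    convˡ a (&L (distinctˡ a) p (convˡ⁻ b (sound P _ D)))
  sound° (branch x Ps) ρ (branch a ⊕L Ds) = convˡ a (⊕L (distinctˡ a) (sound-⊕L Ps ρ Ds))
  sound° (branch x Ps) ρ (branch a &R Ds) = convʳ a (&R (distinctʳ a) (sound-&R Ps ρ Ds))
  sound° (serve x P) ρ (serve a !R u D) =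
    conv (⟦Add⟧ᵘ a) (trans (sym (⟦Unr⟧ˡ u)) (⟦Addʳ⟧ˡ a)) (⟦Addʳ-Unr⟧ʳ a (⟦Unr⟧ʳ u))
      (!R (singleton-distinct a) (conv-∙ refl (⟦Unr⟧ˡ u) (⟦Unr⟧ʳ u) (sound P _ D)))
  sound° (serve x P) ρ (serve a ⁇L u D) =
    conv (⟦Add⟧ᵘ a) (⟦Addˡ-Unr⟧ˡ a u) (trans (sym (⟦Unr⟧ʳ u)) (⟦Addˡ⟧ʳ a))
      (⁇L (singleton-distinct a) (conv-∙ refl (⟦Unr⟧ˡ u) (⟦Unr⟧ʳ u) (sound P _ D)))
  sound° (fwd x y) ρ (fwd a b idR u) =
    conv (trans (⟦Add⟧ᵘ a) (⟦Add⟧ᵘ b)) (trans (⟦Addˡ-Unr⟧ˡ a u) (⟦Addʳ⟧ˡ b))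
         (⟦Addʳ-Unr⟧ʳ b (trans (sym (⟦Addˡ⟧ʳ a)) (⟦Unr⟧ʳ u)))
      (idR (pair-distinct a b))
  sound° (fwd x y) ρ (fwd a b idL u) =
    conv (trans (⟦Add⟧ᵘ a) (⟦Add⟧ᵘ b))
         (trans (cong (_⸴ _ ∶ _) (⟦Addˡ-Unr⟧ˡ a u)) (⟦Addˡ⟧ˡ b))
         (trans (sym (⟦Unr⟧ʳ u)) (trans (⟦Addˡ⟧ʳ a) (⟦Addˡ⟧ʳ b)))
      (idL (pair-distinct a b))
  sound° (close x 𝟎) ρ (close a 𝟏R u) =
    conv (⟦Add⟧ᵘ a) (trans (sym (⟦Unr⟧ˡ u)) (⟦Addʳ⟧ˡ a)) (⟦Addʳ-Unr⟧ʳ a (⟦Unr⟧ʳ u))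
      (𝟏R (singleton-distinct a))
  sound° (close x 𝟎) ρ (close a ⊥L u) =
    conv (⟦Add⟧ᵘ a) (⟦Addˡ-Unr⟧ˡ a u) (trans (sym (⟦Unr⟧ʳ u)) (⟦Addˡ⟧ʳ a))
      (⊥L (singleton-distinct a))
  sound° (wait x P) ρ (wait a 𝟏L D) = convˡ a (𝟏L (distinctˡ a) (sound P ρ D))
  sound° (wait x P) ρ (wait a ⊥R D) = convʳ a (⊥R (distinctʳ a) (sound P ρ D))

  sound-⊕L : ∀ {As} (Ps : Branches (Proc m)) (ρ : Fin m → Fin n) →
    Pointwise (λ A P → ∃[ Θ ] Add Θ₀ x (left A) Θ × (Θ ⊢ P)) As (renameAll ρ Ps) →
    Pointwise (λ A P → ⟦ Θ₀ ⟧ᵘ ⨾ ⟦ Θ₀ ⟧ˡ ⸴ x ∶ A ⊢ P ⦂ ⟦ Θ₀ ⟧ʳ) As (renameAll ρ Ps)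
  sound-⊕L (last P)    ρ (last (_ , a , D))    = last (convˡ⁻ a (sound P ρ D))
  sound-⊕L (cons P Ps) ρ (cons (_ , a , D) Ds) =
    cons (convˡ⁻ a (sound P ρ D)) (sound-⊕L Ps ρ Ds)
  sound-⊕L (skip Ps)   ρ (skip Ds)             = skip (sound-⊕L Ps ρ Ds)

  sound-&R : ∀ {As} (Ps : Branches (Proc m)) (ρ : Fin m → Fin n) →
    Pointwise (λ A P → ∃[ Θ ] Add Θ₀ x (right A) Θ × (Θ ⊢ P)) As (renameAll ρ Ps) →
    Pointwise (λ A P → ⟦ Θ₀ ⟧ᵘ ⨾ ⟦ Θ₀ ⟧ˡ ⊢ P ⦂ ⟦ Θ₀ ⟧ʳ ⸴ x ∶ A) As (renameAll ρ Ps)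
  sound-&R (last P)    ρ (last (_ , a , D))    = last (convʳ⁻ a (sound P ρ D))
  sound-&R (cons P Ps) ρ (cons (_ , a , D) Ds) =
    cons (convʳ⁻ a (sound P ρ D)) (sound-&R Ps ρ Ds)
  sound-&R (skip Ps)   ρ (skip Ds)             = skip (sound-&R Ps ρ Ds)

-- Distinctness of names in derivable judgments, and conclusion

disjoint-⸴ : (c Γ Δ : Ctx n) → Disjoint c Γ → Disjoint c Δ → Disjoint c (Γ ⸴ Δ)
disjoint-⸴ c Γ Δ p q i (r , t) = ¬nothing-just
  (⸴-fresh {Γ = Γ} {Δ = Δ} (¬just⇒nothing λ u → p i (r , u)) (¬just⇒nothing λ u → q i (r , u))) t

disjoint-∅ : (c : Ctx n) → Disjoint c ∅
disjoint-∅ c i (_ , t) = ¬nothing-just (∅-fresh {x = i}) t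

fuse : ∀ (cs : List (Ctx n)) {Γ Δ ds} →
  Distinct (cs ++ Γ ∷ Δ ∷ ds) → Distinct (cs ++ (Γ ⸴ Δ) ∷ ds)
fuse [] {Γ} {Δ} ((_ ∷ p) ∷ q ∷ d) = All.zipWith (λ {c} (p , q) →
  disjoint-sym c (Γ ⸴ Δ) (disjoint-⸴ c Γ Δ (disjoint-sym Γ c p) (disjoint-sym Δ c q))) (p , q) ∷ d
fuse (c ∷ cs) {Γ} {Δ} (p ∷ d) with ++⁻ʳ cs p
... | q ∷ r ∷ t = ++⁺ (++⁻ˡ cs p) (disjoint-⸴ c Γ Δ q r ∷ t) ∷ fuse cs d

insert-∅ : ∀ (cs : List (Ctx n)) {ds} → Distinct (cs ++ ds) → Distinct (cs ++ ∅ ∷ ds)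
insert-∅ [] d = All.universal (λ c → disjoint-sym c ∅ (disjoint-∅ c)) _ ∷ d
insert-∅ (c ∷ cs) (p ∷ d) = ++⁺ (++⁻ˡ cs p) (disjoint-∅ c ∷ ++⁻ʳ cs p) ∷ insert-∅ cs d

-- `merge` would forget assignments of overlapping contexts. This rules overlaps out, so that the
-- round trip through the syntax-directed system returns to the original judgment.
⊢-distinct : Γ ⨾ Δ ⊢ P ⦂ Λ → Distinct (Γ ∷ Δ ∷ Λ ∷ [])
⊢-distinct (idR d)      = d
⊢-distinct (idL d)      = insert-∅ (_ ∷ _ ∷ []) (fuse (_ ∷ []) d)
⊢-distinct (𝟏R d)       = insert-∅ (_ ∷ []) d
⊢-distinct (⊥L d)       = insert-∅ (_ ∷ _ ∷ []) d
⊢-distinct (𝟏L d _)     = fuse (_ ∷ []) d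
⊢-distinct (⊥R d _)     = fuse (_ ∷ _ ∷ []) d
⊢-distinct (⊗R d _ _)   = fuse (_ ∷ _ ∷ []) (fuse (_ ∷ _ ∷ []) (fuse (_ ∷ []) d))
⊢-distinct (⊗L d _)     = fuse (_ ∷ []) d
⊢-distinct (⅋R d _)     = fuse (_ ∷ _ ∷ []) d
⊢-distinct (⅋L d _ _)   = fuse (_ ∷ _ ∷ []) (fuse (_ ∷ []) (fuse (_ ∷ []) d))
⊢-distinct (⊸R d _)     = fuse (_ ∷ _ ∷ []) d
⊢-distinct (⊸L d _ _)   = fuse (_ ∷ _ ∷ []) (fuse (_ ∷ []) (fuse (_ ∷ []) d))
⊢-distinct (⊕R d _ _)   = fuse (_ ∷ _ ∷ []) d
⊢-distinct (⊕L d _)     = fuse (_ ∷ []) d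
⊢-distinct (&R d _)     = fuse (_ ∷ _ ∷ []) d
⊢-distinct (&L d _ _)   = fuse (_ ∷ []) d
⊢-distinct (copyR d _)  = fuse [] d
⊢-distinct (copyL d _)  = fuse [] d
⊢-distinct (!R d _)     = insert-∅ (_ ∷ []) d
⊢-distinct (!L d _)     = fuse (_ ∷ []) d
⊢-distinct (⁇R d _)     = fuse (_ ∷ _ ∷ []) d
⊢-distinct (⁇L d _)     = insert-∅ (_ ∷ _ ∷ []) d
⊢-distinct (cutRL d _ _) = fuse (_ ∷ _ ∷ []) (fuse (_ ∷ []) d)
⊢-distinct (cutLR d _ _) = fuse (_ ∷ _ ∷ []) (fuse (_ ∷ []) d)
⊢-distinct (cutRR d _ _) = fuse (_ ∷ _ ∷ []) (fuse (_ ∷ []) d)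
⊢-distinct (cutLL d _ _) = fuse (_ ∷ _ ∷ []) (fuse (_ ∷ []) d)
⊢-distinct (cut!R d _ _) = d
⊢-distinct (cut!L d _ _) = d
⊢-distinct (cut?R d _ _) = d
⊢-distinct (cut?L d _ _) = d

⟦merge⟧ : Distinct (Γ ∷ Δ ∷ Λ ∷ []) →
  ⟦ merge Γ Δ Λ ⟧ᵘ ≡ Γ × ⟦ merge Γ Δ Λ ⟧ˡ ≡ Δ × ⟦ merge Γ Δ Λ ⟧ʳ ≡ Λ
⟦merge⟧ {Γ = Γ} {Δ} {Λ} d =
  ctx-ext (λ i → trans (lookup∘tabulate (unr-part ∘ merge Γ Δ Λ) i)
                       (go (distinct⇒apart d i) .proj₁)) ,
  ctx-ext (λ i → trans (lookup∘tabulate (left-part ∘ merge Γ Δ Λ) i)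
                       (go (distinct⇒apart d i) .proj₂ .proj₁)) ,
  ctx-ext (λ i → trans (lookup∘tabulate (right-part ∘ merge Γ Δ Λ) i)
                       (go (distinct⇒apart d i) .proj₂ .proj₂))
  where
  go : ∀ {r s t} → AtMostOne (r ∷ s ∷ t ∷ []) →
    unr-part (entry r s t) ≡ r × left-part (entry r s t) ≡ s × right-part (entry r s t) ≡ t
  go (just (refl ∷ refl ∷ []))     = refl , refl , refl
  go (nothing (just (refl ∷ [])))  = refl , refl , refl
  go (nothing (nothing (just []))) = refl , refl , refl
  go (nothing (nothing (nothing []))) = refl , refl , refl

mainTheorem1 : ∀ (n : ℕ) (Γ Δ Λ : Ctx n) (P Q : Proc n) →
    Γ ⨾ Δ ⊢ P ⦂ Λ → P ≅ Q → Γ ⨾ Δ ⊢ Q ⦂ Λ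
mainTheorem1 n Γ Δ Λ P Q D P≅Q =
  let u , l , r = ⟦merge⟧ (⊢-distinct D)
  -- `sound` speaks of renamed processes only, so `Q` is presented as its renaming along the
  -- identity.
  in conv u l r (subst (merge Γ Δ Λ ⊩_) (rename-id (λ _ → refl) Q)
       (sound Q id (subst (merge Γ Δ Λ ⊢_) (sym (rename-id (λ _ → refl) Q))
         (≅⇒⊑ P≅Q hole (complete D)))))
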